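{- Let $\mathcal{F}$ be a $2$-$\Delta$-capturing construction scheme and assume $\mathfrak{m}^\Delta_\mathcal{F}>\omega_1$. Then every ccc forcing $\mathbb{P}$ $2$-$\Delta$-preserves $\mathcal{F}$.
   Context: Construction schemes: a type is a sequence $\langle m_k,n_{k+1},r_{k+1}\rangle_{k\in\omega}$ with $m_0=1$, $n_{k+1}\geq2$, $m_k>r_{k+1}$, $m_{k+1}=r_{k+1}+(m_k-r_{k+1})n_{k+1}$. A construction scheme of this type is a family $\mathcal{F}$ of nonempty finite subsets of $\omega_1$, cofinal under $\subseteq$, each member of size $m_k$ for some $k$, such that with $\mathcal{F}_k=\{F\in\mathcal{F}:|F|=m_k\}$: (i) for $E,F\in\mathcal{F}_k$, $E\cap F$ is an initial segment of $E$ and of $F$; (ii) each $F\in\mathcal{F}_{k+1}$ is $F_0\cup\dots\cup F_{n_{k+1}-1}$ with $F_i\in\mathcal{F}_k$ a $\Delta$-system with root $R(F)$, $|R(F)|=r_{k+1}$, $R(F)<F_0\setminus R(F)<\dots<F_{n_{k+1}-1}\setminus R(F)$. Let $\rho(\alpha,\beta)=\min\{k:\exists F\in\mathcal{F}_k\ \{\alpha,\beta\}\subseteq F\}$, $\|\alpha\|_k=|\{\xi<\alpha:\rho(\alpha,\xi)\leq k\}|$, $\Delta(\alpha,\beta)=$ least $k$ with $\|\alpha\|_k\ne\|\beta\|_k$ ($\omega$ if none). $\Xi_\alpha(0)=0$ and for $k\geq1$, for any $F\in\mathcal{F}_k$ containing $\alpha$, $\Xi_\alpha(k)=-1$ if $\alpha\in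 R(F)$, $=i$ if $\alpha\in F_i\setminus R(F)$. For finite $X\subseteq\omega_1$, $X(i)$ is its $i$-th element. A pair $\langle D_0,D_1\rangle$ of sets in $[\omega_1]^m$ is $\Delta$-captured at level $l$ if it is a $\Delta$-system with root $R$ of size $r$, $R<D_j\setminus R$, tails $<$-comparable, $\Xi_{D_j(a)}(l)=-1$ for $a<r$ and $=j$ for $a\geq r$, and $\Delta(D_0(a),D_1(a))=l$ for $r\leq a<m$. $\mathcal{F}$ is $2$-$\Delta$-capturing if for every uncountable family $\mathcal{S}$ of finite subsets of $\omega_1$ there are infinitely many $l$ for which some two members of $\mathcal{S}$ are $\Delta$-captured at level $l$. A forcing $2$-$\Delta$-preserves $\mathcal{F}$ if it forces $\mathcal{F}$ to be $2$-$\Delta$-capturing. For a forcing $\mathbb{P}$, $\mathfrak{m}(\mathbb{P})$ is the least $\kappa$ such that there are $\kappa$ dense subsets of $\mathbb{P}$ not all met by one filter; $\mathfrak{m}^\Delta_\mathcal{F}$ is the minimum of $\mathfrak{m}(\mathbb{P})$ over all ccc forcings $\mathbb{P}$ that $2$-$\Delta$-preserve $\mathcal{F}$. -}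

module Defs where

open import Level using (Level; 0ℓ; _⊔_) renaming (suc to lsuc)
open import Data.Nat as ℕ using (ℕ; zero; suc; _+_; _*_; _∸_)
open import Data.Integer using (ℤ; 0ℤ; -1ℤ; +_)
open import Data.Fin as Fin using (Fin; toℕ)
open import Data.Vec using (Vec; lookup)
open import Data.Product using (Σ; ∃; Σ-syntax; ∃-syntax; _×_; _,_)
open import Data.Sum using (_⊎_)
open import Data.Unit using (⊤)
open import Function.Bundles using (_↣_)
open import Induction.WellFounded using (WellFounded)
open import Relation.Binary.Core using (Rel)
open import Relation.Binary.Structures using (IsStrictTotalOrder; IsPreorder)
open import Relation.Binary.PropositionalEquality using (_≡_; _≢_)
open import Relation.Nullary using (¬_)
open import Relation.Unary using (Pred; _∈_; _∉_; _⊆_; _≐_; _∩_; _∖_; ⋃)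

Countable : {A : Set} → Pred A 0ℓ → Set
Countable {A} S =
  Σ[ f ∈ (A → ℕ) ] (∀ x y → x ∈ S → y ∈ S → f x ≡ f y → x ≡ y)

Uncountable : {A : Set} → Pred A 0ℓ → Set
Uncountable S = ¬ Countable S

-- ω₁, characterised up to isomorphism as an uncountable well-order all of
-- whose proper initial segments are countable.
record Omega₁ : Set₁ where
  infix 4 _<_ _≺_
  field
    Ordinal            : Set
    _<_                : Rel Ordinal 0ℓ
    isStrictTotalOrder : IsStrictTotalOrder _≡_ _<_
    wellFounded        : WellFounded _<_
    segments-countable : ∀ α → Countable (λ ξ → ξ < α)
    uncountable        : Uncountable {Ordinal} (λ _ → ⊤)

  _≺_ : Pred Ordinal 0ℓ → Pred Ordinal 0ℓ → Set
  A ≺ B = ∀ {α β} → α ∈ A → β ∈ B → α < β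

  InitialSegment : Pred Ordinal 0ℓ → Pred Ordinal 0ℓ → Set
  InitialSegment A E =
    A ⊆ E × (∀ {ξ α} → ξ ∈ E → α ∈ A → ξ < α → ξ ∈ A)

-- A finite subset of ω₁ of size n is given by its increasing enumeration.
-- The irrelevant field makes equality of subsets equality of enumerations.
record [_]^_ (Ω : Omega₁) (n : ℕ) : Set where
  constructor enum
  open Omega₁ Ω
  field
    elements    : Vec Ordinal n
    .increasing : ∀ {i j} → i Fin.< j → lookup elements i < lookup elements j

FinSubset : Omega₁ → Set
FinSubset Ω = ∃[ n ] ([ Ω ]^ n)

module _ {Ω : Omega₁} where

  open Omega₁ Ω

  infix 9 _⟨_⟩

  -- X ⟨ i ⟩ is the i-th element X(i) of X in increasing order.
  _⟨_⟩ : ∀ {n} → [ Ω ]^ n → Fin n → Ordinal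
  X ⟨ i ⟩ = lookup ([_]^_.elements X) i

  El : ∀ {n} → [ Ω ]^ n → Pred Ordinal 0ℓ
  El X α = ∃[ i ] X ⟨ i ⟩ ≡ α

  HasSize : Pred Ordinal 0ℓ → ℕ → Set
  HasSize A n = Σ[ X ∈ [ Ω ]^ n ] (El X ≐ A)

  -- The indexed family D lists, without repetition, a Δ-system with root R.
  IsΔSystem : ∀ {N s r} → (Fin N → [ Ω ]^ s) → [ Ω ]^ r → Set
  IsΔSystem D R =
    ∀ i j → i ≢ j → D i ≢ D j × (El (D i) ∩ El (D j)) ≐ El R

-- n₊ k and r₊ k stand for n_{k+1} and r_{k+1}.
record SchemeType : Set where
  field
    m     : ℕ → ℕ
    n₊    : ℕ → ℕ
    r₊    : ℕ → ℕ
    m₀≡1  : m 0 ≡ 1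
    2≤n₊  : ∀ k → 2 ℕ.≤ n₊ k
    r₊<m  : ∀ k → r₊ k ℕ.< m k
    m-suc : ∀ k → m (suc k) ≡ r₊ k + (m k ∸ r₊ k) * n₊ k

module _ {Ω : Omega₁} (τ : SchemeType) (𝓕 : Pred (FinSubset Ω) 0ℓ) where

  open Omega₁ Ω
  open SchemeType τ

  Level-member : (k : ℕ) → Pred ([ Ω ]^ (m k)) 0ℓ
  Level-member k F = (m k , F) ∈ 𝓕

  -- G lists F₀ , … , F_{n_{k+1}-1} and R is R(F).  Since the sizes are
  -- prescribed, G and R are determined by F.
  record Decomposition {k : ℕ} (F : [ Ω ]^ (m (suc k)))
                       (G : Fin (n₊ k) → [ Ω ]^ (m k))
                       (R : [ Ω ]^ (r₊ k)) : Set where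
    field
      members    : ∀ i → G i ∈ Level-member k
      union      : El F ≐ ⋃ (Fin (n₊ k)) (λ i → El (G i))
      Δ-system   : IsΔSystem G R
      root-below : ∀ i → El R ≺ (El (G i) ∖ El R)
      tails      : ∀ i j → i Fin.< j →
                   (El (G i) ∖ El R) ≺ (El (G j) ∖ El R)

record ConstructionScheme (Ω : Omega₁) (τ : SchemeType) : Set₁ where
  open Omega₁ Ω using (InitialSegment)
  open SchemeType τ
  field
    𝓕             : Pred (FinSubset Ω) 0ℓ
    nonempty      : ∀ {n} (F : [ Ω ]^ n) → (n , F) ∈ 𝓕 → 0 ℕ.< n
    sizes         : ∀ {n} (F : [ Ω ]^ n) → (n , F) ∈ 𝓕 → ∃[ k ] n ≡ m k
    cofinal       : ∀ {n} (X : [ Ω ]^ n) →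
                    ∃[ s ] Σ[ F ∈ [ Ω ]^ s ] ((s , F) ∈ 𝓕 × El X ⊆ El F)
    intersections : ∀ k (E F : [ Ω ]^ (m k)) →
                    E ∈ Level-member τ 𝓕 k → F ∈ Level-member τ 𝓕 k →
                    InitialSegment (El E ∩ El F) (El E) ×
                    InitialSegment (El E ∩ El F) (El F)
    decomposes    : ∀ k (F : [ Ω ]^ (m (suc k))) →
                    F ∈ Level-member τ 𝓕 (suc k) →
                    ∃[ G ] ∃[ R ] Decomposition τ 𝓕 F G R

-- The functions ρ, ‖_‖, Δ and Ξ are given by their graphs.
module _ {Ω : Omega₁} {τ : SchemeType} (S : ConstructionScheme Ω τ) where

  open Omega₁ Ω
  open SchemeType τ
  open ConstructionScheme S

  CommonMember : Ordinal → Ordinal → Pred ℕ 0ℓ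
  CommonMember α β k =
    Σ[ F ∈ [ Ω ]^ (m k) ] (F ∈ Level-member τ 𝓕 k × α ∈ El F × β ∈ El F)

  -- ρ(α,β) = k
  ρ[_,_]≡_ : Ordinal → Ordinal → ℕ → Set
  ρ[ α , β ]≡ k =
    CommonMember α β k × (∀ j → CommonMember α β j → k ℕ.≤ j)

  -- ‖α‖ₖ = n
  ‖_‖[_]≡_ : Ordinal → ℕ → ℕ → Set
  ‖ α ‖[ k ]≡ n =
    HasSize {Ω} (λ ξ → ξ < α × (∃[ j ] (ρ[ α , ξ ]≡ j × j ℕ.≤ k))) n

  -- Δ(α,β) = l for l < ω; the value ω is never referred to.
  Δ[_,_]≡_ : Ordinal → Ordinal → ℕ → Set
  Δ[ α , β ]≡ l =
    (∃[ a ] ∃[ b ] (‖ α ‖[ l ]≡ a × ‖ β ‖[ l ]≡ b × a ≢ b)) ×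
    (∀ k → k ℕ.< l → ∃[ a ] (‖ α ‖[ k ]≡ a × ‖ β ‖[ k ]≡ a))

  -- Ξ_α(k) = v.  The value does not depend on the chosen F.
  Ξ[_,_]≡_ : Ordinal → ℕ → ℤ → Set
  Ξ[ α , zero  ]≡ v = v ≡ 0ℤ
  Ξ[ α , suc k ]≡ v =
    Σ[ F ∈ [ Ω ]^ (m (suc k)) ]
      (F ∈ Level-member τ 𝓕 (suc k) × α ∈ El F ×
       (∃[ G ] ∃[ R ]
         (Decomposition τ 𝓕 F G R ×
          ((α ∈ El R × v ≡ -1ℤ) ⊎
           (∃[ i ] (α ∈ (El (G i) ∖ El R) × v ≡ + toℕ i))))))

  record ΔCaptured {s : ℕ} (D : Fin 2 → [ Ω ]^ s) (l : ℕ) : Set where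
    field
      r               : ℕ
      R               : [ Ω ]^ r
      Δ-system        : IsΔSystem D R
      root-below      : ∀ j → El R ≺ (El (D j) ∖ El R)
      comparable      : ((El (D Fin.zero) ∖ El R) ≺ (El (D (Fin.suc Fin.zero)) ∖ El R))
                      ⊎ ((El (D (Fin.suc Fin.zero)) ∖ El R) ≺ (El (D Fin.zero) ∖ El R))
      Ξ-root          : ∀ j a → toℕ a ℕ.< r → Ξ[ D j ⟨ a ⟩ , l ]≡ -1ℤ
      Ξ-tail          : ∀ j a → r ℕ.≤ toℕ a → Ξ[ D j ⟨ a ⟩ , l ]≡ (+ toℕ j)
      Δ-tail          : ∀ a → r ℕ.≤ toℕ a →
                        Δ[ D Fin.zero ⟨ a ⟩ , D (Fin.suc Fin.zero) ⟨ a ⟩ ]≡ l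

  TwoΔCapturing : Set₁
  TwoΔCapturing =
    (𝓢 : Pred (FinSubset Ω) 0ℓ) → Uncountable 𝓢 →
    ∀ N → ∃[ l ] (N ℕ.≤ l ×
      (∃[ s ] Σ[ D ∈ (Fin 2 → [ Ω ]^ s) ]
        ((∀ j → (s , D j) ∈ 𝓢) × ΔCaptured D l)))

-- Smaller conditions are stronger.
record Forcing : Set₁ where
  infix 4 _≤_
  field
    Condition  : Set
    _≤_        : Rel Condition 0ℓ
    isPreorder : IsPreorder _≡_ _≤_
    inhabitant : Condition

module _ (P : Forcing) where

  open Forcing P

  Compatible : Rel Condition 0ℓ
  Compatible p q = ∃[ r ] (r ≤ p × r ≤ q)

  Antichain : Pred Condition 0ℓ → Set
  Antichain A = ∀ p q → p ∈ A → q ∈ A → p ≢ q → ¬ Compatible p q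

  CCC : Set₁
  CCC = (A : Pred Condition 0ℓ) → Antichain A → Countable A

  Dense : Pred Condition 0ℓ → Set
  Dense D = ∀ p → ∃[ q ] (q ≤ p × q ∈ D)

  record IsFilter (G : Pred Condition 0ℓ) : Set where
    field
      nonempty : ∃[ p ] p ∈ G
      upward   : ∀ p q → p ≤ q → p ∈ G → q ∈ G
      directed : ∀ p q → p ∈ G → q ∈ G → ∃[ r ] (r ∈ G × r ≤ p × r ≤ q)

  -- There are |I| dense sets not all met by one filter; 𝔪(P) is the least
  -- such cardinality.
  UnmetFamily : Set → Set₁
  UnmetFamily I =
    Σ[ D ∈ (I → Pred Condition 0ℓ) ]
      ((∀ i → Dense (D i)) ×
       ¬ (∃[ G ] (IsFilter G × (∀ i → ∃[ p ] (p ∈ G × p ∈ D i)))))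

-- The forcing relation: a sentence of the forcing language is represented by
-- the set of conditions forcing it, and the connectives follow the usual
-- recursive clauses.  ⌜ A ⌝ is an absolute ground-model statement.  ∀ᶠ and ∃ᶠ
-- range over a class X of names: check names when X is a ground-model set,
-- names for subsets of a ground-model set A when X is Name A.
module ForcingRelation (P : Forcing) where

  open Forcing P

  private
    variable
      a b : Level

  infixr 6 _∧ᶠ_
  infixr 5 _⇒ᶠ_
  infix  7 _∈ᶠ_

  DenseBelow : Condition → Pred Condition a → Set a
  DenseBelow p D = ∀ q → q ≤ p → ∃[ r ] (r ≤ q × r ∈ D)

  Sentence : (a : Level) → Set (lsuc a)
  Sentence a = Pred Condition a

  -- A set of pairs (x̌ , q); every subset of A in the extension has such a name.
  Name : Set → Set₁
  Name A = A → Condition → Set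

  _∈ᶠ_ : {A : Set} → A → Name A → Sentence 0ℓ
  (x ∈ᶠ Ṡ) p = DenseBelow p (λ r → ∃[ q ] (Ṡ x q × r ≤ q))

  ⌜_⌝ : Set a → Sentence a
  ⌜ A ⌝ p = A

  _∧ᶠ_ : Sentence a → Sentence b → Sentence (a ⊔ b)
  (φ ∧ᶠ ψ) p = φ p × ψ p

  _⇒ᶠ_ : Sentence a → Sentence b → Sentence (a ⊔ b)
  (φ ⇒ᶠ ψ) p = ∀ q → q ≤ p → φ q → ψ q

  ¬ᶠ_ : Sentence a → Sentence a
  (¬ᶠ φ) p = ∀ q → q ≤ p → ¬ φ q

  ∀ᶠ : (X : Set a) → (X → Sentence b) → Sentence (a ⊔ b)
  ∀ᶠ X φ p = ∀ x → φ x p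

  ∃ᶠ : (X : Set a) → (X → Sentence b) → Sentence (a ⊔ b)
  ∃ᶠ X φ p = DenseBelow p (λ q → ∃[ x ] φ x q)

  -- Some function, given by a name for its graph, is injective on Ṡ.
  Countableᶠ : {A : Set} → Name A → Sentence (lsuc 0ℓ)
  Countableᶠ {A} Ṡ =
    ∃ᶠ (Name (A × ℕ)) λ ḟ →
      (∀ᶠ A λ x → x ∈ᶠ Ṡ ⇒ᶠ ∃ᶠ ℕ λ n → (x , n) ∈ᶠ ḟ) ∧ᶠ
      (∀ᶠ A λ x → ∀ᶠ ℕ λ n → ∀ᶠ ℕ λ n′ →
        ((x , n) ∈ᶠ ḟ ∧ᶠ (x , n′) ∈ᶠ ḟ) ⇒ᶠ ⌜ n ≡ n′ ⌝) ∧ᶠ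
      (∀ᶠ A λ x → ∀ᶠ A λ y → ∀ᶠ ℕ λ n →
        (x ∈ᶠ Ṡ ∧ᶠ y ∈ᶠ Ṡ ∧ᶠ (x , n) ∈ᶠ ḟ ∧ᶠ (y , n) ∈ᶠ ḟ) ⇒ᶠ ⌜ x ≡ y ⌝)

  Uncountableᶠ : {A : Set} → Name A → Sentence (lsuc 0ℓ)
  Uncountableᶠ Ṡ = ¬ᶠ Countableᶠ Ṡ

  -- TwoΔCapturing, read in the extension.  Finite subsets of ω₁ are ground-model
  -- sets, and ΔCaptured is absolute, being a property of such sets and 𝓕.
  TwoΔCapturingᶠ : {Ω : Omega₁} {τ : SchemeType} →
                   ConstructionScheme Ω τ → Sentence (lsuc 0ℓ)
  TwoΔCapturingᶠ {Ω} S =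
    ∀ᶠ (Name (FinSubset Ω)) λ 𝓢̇ → Uncountableᶠ 𝓢̇ ⇒ᶠ
      ∀ᶠ ℕ λ N → ∃ᶠ ℕ λ l → ⌜ N ℕ.≤ l ⌝ ∧ᶠ
        ∃ᶠ ℕ λ s → ∃ᶠ (Fin 2 → [ Ω ]^ s) λ D →
          (∀ᶠ (Fin 2) λ j → (s , D j) ∈ᶠ 𝓢̇) ∧ᶠ ⌜ ΔCaptured S D l ⌝

-- 𝓕 lives on the ground-model ω₁, so this is the intended notion for forcings
-- preserving ω₁, in particular for ccc ones.
TwoΔPreserves : {Ω : Omega₁} {τ : SchemeType} →
                Forcing → ConstructionScheme Ω τ → Set₁
TwoΔPreserves P S = ∀ p → TwoΔCapturingᶠ S p
  where open ForcingRelation P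

-- 𝔪^Δ_𝓕 > ω₁: the minimum of the 𝔪(P) exceeds ω₁ when no cardinality |I| of a
-- family as above, for any ccc P that 2-Δ-preserves 𝓕, is at most ω₁.
𝔪Δ>ω₁ : {Ω : Omega₁} {τ : SchemeType} → ConstructionScheme Ω τ → Set₁
𝔪Δ>ω₁ {Ω} S =
  (P : Forcing) → CCC P → TwoΔPreserves P S →
  (I : Set) → UnmetFamily P I → ¬ (I ↣ Omega₁.Ordinal Ω)

{-# OPTIONS --safe #-}

-- Let P be ccc and let conditions c X force X ∈ 𝓢̇ for uncountably many finite
-- sets X, which may be thinned to a Δ-system.  Consider the forcing ℙ of finite
-- sets of such X, any two of which are captured at some level ≥ N.  Given
-- uncountably many conditions of ℙ, cover each, together with any further finite
-- set, by one finite set, make all order patterns equal and capture two covers at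
-- a level above all levels occurring inside the conditions.  Corresponding parts
-- of the covers are then captured at that level and have equal ‖·‖ₖ and Ξ at
-- all lower levels, so the union of the two conditions is again a condition.  Hence ℙ is
-- ccc and 2-Δ-preserves 𝓕, and the hypothesis on 𝔪^Δ yields an uncountable set of
-- pairwise captured X.  If no two captured X, Y had compatible c X, c Y, then these
-- c X would form an uncountable antichain of P.
module Submission where

open import Level using (0ℓ)
open import Defs
open import Axiom.ExcludedMiddle using (ExcludedMiddle)
open import Data.Empty using (⊥; ⊥-elim-irr)
open import Data.Fin as Fin using (Fin; zero; suc; toℕ)
import Data.Fin.Properties as Fin
open import Data.Integer using (-1ℤ; +_)
open import Data.List as List using (List; []; _∷_; _++_)
open import Data.List.Membership.Propositional renaming (_∈_ to _∈ˡ_) using ()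
open import Data.List.Membership.Propositional.Properties
  using (∈-map⁺; ∈-map⁻; ∈-++⁺ˡ; ∈-++⁺ʳ; ∈-++⁻; ∈-tabulate⁺)
open import Data.List.Relation.Unary.Any using (here; there)
open import Data.Nat as ℕ using (ℕ; zero; suc; _+_; _*_; z≤n; s≤s)
import Data.Nat.Properties as ℕ
open import Data.Product using (Σ; Σ-syntax; ∃-syntax; _×_; _,_; proj₁; proj₂)
open import Data.Sum as Sum using (_⊎_; inj₁; inj₂)
open import Data.Unit using (⊤; tt)
open import Data.Vec using (Vec; []; _∷_; lookup; tabulate)
import Data.Vec.Properties as Vec
open import Function using (_∘_; id)
open import Function.Bundles using (mk↣)
open import Induction.WellFounded using (Acc; acc)
open import Relation.Binary.Definitions using (tri<; tri≈; tri>)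
open import Relation.Binary.PropositionalEquality
  using (_≡_; _≢_; refl; sym; trans; cong; cong₂; subst; subst₂; isEquivalence)
open import Relation.Binary.Structures using (IsStrictTotalOrder; IsPreorder)
open import Relation.Nullary using (¬_; Dec; yes; no; contradiction)
open import Relation.Unary using (Pred; _∈_; _∉_; _⊆_; _≐_; _∖_)

-- Injective codings into ℕ

-- Twins share norms and values of `Ξ`, but this says nothing about how sets meet. The Δ-system, the
-- position of its root and the order of the tails are therefore fixed for all pairs of `T` before
-- any forcing. Equality of `Ξ` below the level of capture comes from the norms: ‖α‖ₖ is the index
-- of α in every member of 𝓕ₖ containing it, and the members of one level are decomposed alike.
-- Density is a separate obstacle, since a condition may have no extension reaching far up in ω₁. So
-- ℙ consists only of extensions of a suitable list `A₀`. If there were none, every X would lie in a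
-- coherent list whose extensions stay below some hi X, and two cross-linked lists with hi X < lo Y
-- would break this bound. The further finite set covered along with a condition is empty for the
-- ccc. For preservation it is the member of the family that is to be captured, so that one capture
-- yields both the captured pair and the compatibility of the conditions.

abstract
  pair : ℕ → ℕ → ℕ
  pair a b = (a + b) * (a + b) + a

  -- With s = a + b the code lies between s² and s² + s, and s² + s < (s + 1)². So the intervals for
  -- different s are disjoint, and the code determines the sum first.
  pair-< : ∀ a b c d → a + b ℕ.< c + d → pair a b ℕ.< pair c d
  pair-< a b c d lt = begin-strict
      s * s + a           ≤⟨ ℕ.+-monoʳ-≤ (s * s) (ℕ.m≤m+n a b) ⟩
      s * s + s           ≡⟨ ℕ.+-comm (s * s) s ⟩
      suc s * s           <⟨ ℕ.*-monoʳ-< (suc s) (ℕ.n<1+n s) ⟩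
      suc s * suc s       ≤⟨ ℕ.*-mono-≤ lt lt ⟩
      (c + d) * (c + d)   ≤⟨ ℕ.m≤m+n _ c ⟩
      pair c d            ∎
      where
      open ℕ.≤-Reasoning
      s : ℕ
      s = a + b

  pair-injective : ∀ a b c d → pair a b ≡ pair c d → a ≡ c × b ≡ d
  pair-injective a b c d eq with ℕ.<-cmp (a + b) (c + d)
  ... | tri< lt _ _ = contradiction eq (ℕ.<⇒≢ (pair-< a b c d lt))
  ... | tri> _ _ gt = contradiction (sym eq) (ℕ.<⇒≢ (pair-< c d a b gt))
  ... | tri≈ _ e _  = a≡c , ℕ.+-cancelˡ-≡ a b d (trans e (cong (_+ d) (sym a≡c)))
    where
    a≡c : a ≡ c
    a≡c = ℕ.+-cancelˡ-≡ ((a + b) * (a + b)) a c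
            (trans eq (cong (λ s → s * s + c) (sym e)))

encodeFun : ∀ n → (Fin n → ℕ) → ℕ
encodeFun zero    f = 0
encodeFun (suc n) f = pair (f zero) (encodeFun n (f ∘ suc))

encodeFun-injective : ∀ n f g → encodeFun n f ≡ encodeFun n g → ∀ i → f i ≡ g i
encodeFun-injective (suc n) f g eq zero    = proj₁ (pair-injective _ _ _ _ eq)
encodeFun-injective (suc n) f g eq (suc i) =
  encodeFun-injective n (f ∘ suc) (g ∘ suc) (proj₂ (pair-injective _ _ _ _ eq)) i

encodeList : List ℕ → ℕ
encodeList []       = 0
encodeList (n ∷ ns) = suc (pair n (encodeList ns))

encodeList-injective : ∀ ms ns → encodeList ms ≡ encodeList ns → ms ≡ ns
encodeList-injective []       []       eq = refl
encodeList-injective (m ∷ ms) (n ∷ ns) eq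
  with pair-injective m (encodeList ms) n (encodeList ns) (ℕ.suc-injective eq)
... | m≡n , eq′ = cong₂ _∷_ m≡n (encodeList-injective ms ns eq′)

-- Countable sets

Countable-⊆ : {A : Set} {S T : Pred A 0ℓ} → S ⊆ T → Countable T → Countable S
Countable-⊆ S⊆T (f , inj) = f , λ x y x∈S y∈S → inj x y (S⊆T x∈S) (S⊆T y∈S)

Countable-subsingleton : {A : Set} {S : Pred A 0ℓ} →
  (∀ x y → x ∈ S → y ∈ S → x ≡ y) → Countable S
Countable-subsingleton h = (λ _ → 0) , λ x y x∈S y∈S _ → h x y x∈S y∈S

Image : {A B : Set} → (A → B) → Pred A 0ℓ → Pred B 0ℓ
Image {A} g S y = Σ[ x ∈ A ] (x ∈ S × g x ≡ y)

Uncountable-Image : {A B : Set} (g : A → B) {S : Pred A 0ℓ} →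
  (∀ x y → x ∈ S → y ∈ S → g x ≡ g y → x ≡ y) →
  Uncountable S → Uncountable (Image g S)
Uncountable-Image g g-inj unc (f , f-inj) = unc
  ( f ∘ g
  , λ x y x∈S y∈S eq → g-inj x y x∈S y∈S
      (f-inj (g x) (g y) (x , x∈S , refl) (y , y∈S , refl) eq))

-- Classical logic and the pigeonhole principle for uncountable sets.

module Classical (em : ∀ {ℓ} → ExcludedMiddle ℓ) where

  abstract

    by-contradiction : ∀ {a} {A : Set a} → ¬ ¬ A → A
    by-contradiction {A = A} ¬¬a with em {P = A}
    ... | yes a = a
    ... | no ¬a = contradiction ¬a ¬¬a

    ¬∀⟶∃¬ : ∀ {a b} {A : Set a} {B : A → Set b} → ¬ (∀ x → B x) → ∃[ x ] ¬ B x
    ¬∀⟶∃¬ ¬all = by-contradiction λ ¬ex →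
      ¬all λ x → by-contradiction λ ¬b → ¬ex (x , ¬b)

    module _ {A : Set} {S : Pred A 0ℓ} where

      Uncountable⇒inhabited : Uncountable S → ∃[ x ] x ∈ S
      Uncountable⇒inhabited unc = by-contradiction λ empty →
        unc (Countable-subsingleton λ x _ x∈S _ → contradiction (x , x∈S) empty)

      -- If all fibres were countable, the colour paired with the code inside its fibre would count
      -- `S`. The counting functions are available together because `Countable` is a Σ-type and
      -- `by-contradiction` yields one for each colour.
      pigeonhole : Uncountable S → (c : A → ℕ) →
                   ∃[ n ] Uncountable (λ x → x ∈ S × c x ≡ n)
      pigeonhole unc c = by-contradiction λ none → unc (union (fibre none))
        where
        Fibre : ℕ → Pred A 0ℓ
        Fibre n x = x ∈ S × c x ≡ n

        fibre : ¬ (∃[ n ] Uncountable (Fibre n)) → ∀ n → Countable (Fibre n)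
        fibre none n = by-contradiction λ unc-n → none (n , unc-n)

        union : (∀ n → Countable (Fibre n)) → Countable S
        union ct = (λ x → pair (c x) (proj₁ (ct (c x)) x)) , inj
          where
          inj : ∀ x y → x ∈ S → y ∈ S → _ → x ≡ y
          inj x y x∈S y∈S eq = proj₂ (ct (c x)) x y (x∈S , refl) (y∈S , sym c≡)
            (trans (proj₂ p) (cong (λ n → proj₁ (ct n) y) (sym c≡)))
            where
            p = pair-injective (c x) (proj₁ (ct (c x)) x) (c y) (proj₁ (ct (c y)) y) eq
            c≡ = proj₁ p

      -- A witness from `h` may depend on the proof of membership. Using the proof found by `em`
      -- makes the choice a function of `x` alone, with `b₀` as the value outside `S`.
      totalize : ∀ {b} {B : Set b} {Q : A → B → Set} → B →
        (∀ x → x ∈ S → ∃[ y ] Q x y) → Σ[ f ∈ (A → B) ] (∀ x → x ∈ S → Q x (f x))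
      totalize {B = B} {Q = Q} b₀ h = f , f-spec
        where
        choose : ∀ x → Dec (x ∈ S) → B
        choose x (yes x∈S) = proj₁ (h x x∈S)
        choose x (no _)    = b₀

        f : A → B
        f x = choose x em

        f-spec : ∀ x → x ∈ S → Q x (f x)
        f-spec x x∈S with em {P = x ∈ S}
        ... | yes p = proj₂ (h x p)
        ... | no ∉S = contradiction x∈S ∉S

-- Ordinals below ω₁

module Ordinals (em : ∀ {ℓ} → ExcludedMiddle ℓ) (Ω : Omega₁) where

  open Omega₁ Ω
  open Classical em
  private module O = IsStrictTotalOrder isStrictTotalOrder

  abstract

    ≮-<-trans : ∀ {α β γ} → ¬ β < α → β < γ → α < γ
    ≮-<-trans {α} {β} β≮α β<γ with O.compare α β
    ... | tri< lt _ _   = O.trans lt β<γ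
    ... | tri≈ _ refl _ = β<γ
    ... | tri> _ _ gt   = contradiction gt β≮α

    <-≮-trans : ∀ {α β γ} → α < β → ¬ γ < β → α < γ
    <-≮-trans {α} {β} {γ} α<β γ≮β with O.compare β γ
    ... | tri< lt _ _   = O.trans α<β lt
    ... | tri≈ _ refl _ = α<β
    ... | tri> _ _ gt   = contradiction gt γ≮β

    least : (P : Pred Ordinal 0ℓ) → ∃[ α ] α ∈ P →
            ∃[ β ] (β ∈ P × (∀ ξ → ξ < β → ξ ∉ P))
    least P (α , α∈P) = go α (wellFounded α) α∈P
      where
      go : ∀ α → Acc _<_ α → α ∈ P → ∃[ β ] (β ∈ P × (∀ ξ → ξ < β → ξ ∉ P))
      go α (acc rs) α∈P with em {P = ∃[ ξ ] (ξ < α × ξ ∈ P)}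
      ... | yes (ξ , ξ<α , ξ∈P) = go ξ (rs ξ<α) ξ∈P
      ... | no none             = α , α∈P , λ ξ ξ<α ξ∈P → none (ξ , ξ<α , ξ∈P)

    closed-segments-countable : ∀ β → Countable (λ ξ → ¬ β < ξ)
    closed-segments-countable β = code , code-inj
      where
      f : Ordinal → ℕ
      f = proj₁ (segments-countable β)

      code : Ordinal → ℕ
      code ξ with O.compare ξ β
      -- Shifted by one: 0 is kept for `β` itself.
      ... | tri< _ _ _ = suc (f ξ)
      ... | tri≈ _ _ _ = 0
      ... | tri> _ _ _ = 0

      code-inj : ∀ x y → ¬ β < x → ¬ β < y → code x ≡ code y → x ≡ y
      code-inj x y x≤β y≤β eq with O.compare x β | O.compare y β
      ... | tri< x<β _ _  | tri< y<β _ _  =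
        proj₂ (segments-countable β) x y x<β y<β (ℕ.suc-injective eq)
      ... | tri≈ _ refl _ | tri≈ _ refl _ = refl
      ... | tri> _ _ β<x  | _             = contradiction β<x x≤β
      ... | _             | tri> _ _ β<y  = contradiction β<y y≤β

    -- Regularity of ω₁ by counting: if the values were unbounded, each α would have a witness x in
    -- `S` with α ≤ g x. Uncountably many α share one witness x₀, yet all of them are at most g x₀.
    Countable⇒bounded : {A : Set} {S : Pred A 0ℓ} → Countable S →
      (g : A → Ordinal) → ∃[ α ] (∀ x → x ∈ S → g x < α)
    Countable⇒bounded {A} {S} (f , f-inj) g =
      by-contradiction λ unbounded → absurd λ α →
        by-contradiction λ none → unbounded
          (α , λ x x∈S → by-contradiction λ g≮α → none (x , x∈S , g≮α))
      where
      absurd : ¬ (∀ α → Σ[ x ∈ A ] (x ∈ S × ¬ g x < α))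
      absurd witness with pigeonhole uncountable (λ α → f (proj₁ (witness α)))
      ... | n , unc with Uncountable⇒inhabited unc
      ...   | α₀ , _ , α₀-fibre =
        unc (Countable-⊆ below (closed-segments-countable (g x₀)))
        where
        x₀ : A
        x₀ = proj₁ (witness α₀)

        below : ∀ {α} → ⊤ × f (proj₁ (witness α)) ≡ n → ¬ g x₀ < α
        below {α} (_ , α-fibre) = subst (λ x → ¬ g x < α)
          (f-inj _ x₀ (proj₁ (proj₂ (witness α))) (proj₁ (proj₂ (witness α₀)))
            (trans α-fibre (sym α₀-fibre)))
          (proj₂ (proj₂ (witness α)))

  module _ (g : Ordinal → Ordinal) where

    ClosurePoint : Pred Ordinal 0ℓ
    ClosurePoint β = ∀ ξ → ξ < β → g ξ < β

    abstract

      private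
        next : ∀ α → ∃[ β ] (α < β × (∀ ξ → ¬ α < ξ → g ξ < β))
        next α = join (Countable⇒bounded (closed-segments-countable α) g)
                      (Countable⇒bounded (closed-segments-countable α) id)
          where
          join : ∃[ β ] (∀ ξ → ¬ α < ξ → g ξ < β) →
                 ∃[ γ ] (∀ ξ → ¬ α < ξ → ξ < γ) →
                 ∃[ β ] (α < β × (∀ ξ → ¬ α < ξ → g ξ < β))
          join (β , gβ) (γ , γ-bound) with O.compare β γ
          ... | tri< β<γ _ _  = γ , γ-bound α (O.irrefl refl) ,
                                λ ξ ξ≤α → O.trans (gβ ξ ξ≤α) β<γ
          ... | tri≈ _ refl _ = β , γ-bound α (O.irrefl refl) , gβ
          ... | tri> _ _ γ<β  = β , O.trans (γ-bound α (O.irrefl refl)) γ<β , gβ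

        sequence-supremum : (seq : ℕ → Ordinal) →
          ∃[ β ] ((∀ n → seq n < β) × (∀ ξ → ξ < β → ¬ (∀ n → seq n < ξ)))
        sequence-supremum seq = least (λ β → ∀ n → seq n < β) (β , λ n → bound n tt)
          where
          all : ∃[ β ] (∀ n → ⊤ → seq n < β)
          all = Countable⇒bounded (id , λ _ _ _ _ eq → eq) seq

          β : Ordinal
          β = proj₁ all

          bound : ∀ n → ⊤ → seq n < β
          bound = proj₂ all

      -- Iterating `next` closes off after ω steps: anything below the least strict upper bound is
      -- at most some `seq n`, so `g` sends it below `seq (suc n)`.
      ClosurePoint-unbounded : ∀ α → ∃[ β ] (ClosurePoint β × α < β)
      ClosurePoint-unbounded α = closed (sequence-supremum seq)
        where
        seq : ℕ → Ordinal
        seq zero    = α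
        seq (suc n) = proj₁ (next (seq n))

        closed : ∃[ β ] ((∀ n → seq n < β) × (∀ ξ → ξ < β → ¬ (∀ n → seq n < ξ))) →
                 ∃[ β ] (ClosurePoint β × α < β)
        closed (β , seq<β , β-least) = β , β-closed , seq<β 0
          where
          β-closed : ClosurePoint β
          β-closed ξ ξ<β =
            let n , seqn≮ξ = ¬∀⟶∃¬ (β-least ξ ξ<β)
            in O.trans (proj₂ (proj₂ (next (seq n))) ξ seqn≮ξ) (seq<β (suc n))

      ClosurePoint-uncountable : Uncountable ClosurePoint
      ClosurePoint-uncountable ct =
        let α , bound     = Countable⇒bounded {S = ClosurePoint} ct id
            β , β∈C , α<β = ClosurePoint-unbounded α
        in O.asym α<β (bound β β∈C)

  abstract

    -- Were all values of `lo` on `S` at most `α`, they would be countably many colours, and one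
    -- colour class would be uncountable.
    countable-fibres⇒unbounded : {A : Set} {S : Pred A 0ℓ} (lo : A → Ordinal) →
      Uncountable S →
      (∀ α → Countable (λ x → x ∈ S × lo x ≡ α)) →
      ∀ α → Σ[ x ∈ A ] (x ∈ S × α < lo x)
    countable-fibres⇒unbounded {A} {S} lo unc fibres α =
      by-contradiction (absurd (closed-segments-countable α))
      where
      absurd : Countable (λ ξ → ¬ α < ξ) → ¬ ¬ (Σ[ x ∈ A ] (x ∈ S × α < lo x))
      absurd (code , code-inj) none with pigeonhole {S = S} unc (code ∘ lo)
      ... | n , unc-n with Uncountable⇒inhabited unc-n
      ...   | x₀ , x₀∈S , x₀-fibre = unc-n (Countable-⊆
        (λ {x} (x∈S , x-fibre) → x∈S ,
          code-inj (lo x) (lo x₀) (λ lt → none (x , x∈S , lt))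
            (λ lt → none (x₀ , x₀∈S , lt)) (trans x-fibre (sym x₀-fibre)))
        (fibres (lo x₀)))

  module _ {A : Set} {S : Pred A 0ℓ} (lo hi : A → Ordinal)
           (lo≤hi : ∀ x → x ∈ S → ¬ hi x < lo x)
           (h : Ordinal → A) (h∈S : ∀ α → h α ∈ S) (h-lo : ∀ α → α < lo (h α)) where

    private
      C : Pred Ordinal 0ℓ
      C = ClosurePoint (hi ∘ h)

      -- The point `β` itself separates: it is above hi (h α) as a closure point and below lo (h β)
      -- by the choice of `h`.
      C-sep : ∀ {α β} → β ∈ C → α < β → hi (h α) < lo (h β)
      C-sep {α} {β} β∈C α<β = O.trans (β∈C α α<β) (h-lo β)

      h-inj-< : ∀ {α β} → β ∈ C → α < β → h α ≢ h β
      h-inj-< {α} {β} β∈C α<β eq = lo≤hi (h β) (h∈S β)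
        (subst (λ x → hi x < lo (h β)) eq (C-sep β∈C α<β))

      h-inj : ∀ α β → α ∈ C → β ∈ C → h α ≡ h β → α ≡ β
      h-inj α β α∈C β∈C eq with O.compare α β
      ... | tri< lt _ _ = contradiction eq (h-inj-< β∈C lt)
      ... | tri≈ _ e _  = e
      ... | tri> _ _ gt = contradiction (sym eq) (h-inj-< α∈C gt)

      S′-sep : ∀ x y → x ∈ Image h C → y ∈ Image h C → x ≢ y →
               hi x < lo y ⊎ hi y < lo x
      S′-sep _ _ (α , α∈C , refl) (β , β∈C , refl) x≢y with O.compare α β
      ... | tri< lt _ _   = inj₁ (C-sep β∈C lt)
      ... | tri≈ _ refl _ = contradiction refl x≢y
      ... | tri> _ _ gt   = inj₂ (C-sep α∈C gt)

    abstract

      separate-along : Σ[ S′ ∈ Pred A 0ℓ ] (S′ ⊆ S × Uncountable S′ ×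
        (∀ x y → x ∈ S′ → y ∈ S′ → x ≢ y → hi x < lo y ⊎ hi y < lo x))
      separate-along = Image h C , (λ { (α , _ , refl) → h∈S α }) ,
        Uncountable-Image h h-inj (ClosurePoint-uncountable (hi ∘ h)) , S′-sep

  abstract

    -- Used twice: to pull apart the tails in the Δ-system lemma, and, with `hi` a bound on coherent
    -- extensions, to refute that every `X` lies in a bounded coherent list.
    separate : {A : Set} {S : Pred A 0ℓ} (lo hi : A → Ordinal) →
      Uncountable S →
      (∀ α → Countable (λ x → x ∈ S × lo x ≡ α)) →
      (∀ x → x ∈ S → ¬ hi x < lo x) →
      Σ[ S′ ∈ Pred A 0ℓ ] (S′ ⊆ S × Uncountable S′ ×
        (∀ x y → x ∈ S′ → y ∈ S′ → x ≢ y → hi x < lo y ⊎ hi y < lo x))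
    separate {A} {S} lo hi unc fibres lo≤hi = separate-along lo hi lo≤hi
      (λ α → proj₁ (above α)) (λ α → proj₁ (proj₂ (above α)))
      (λ α → proj₂ (proj₂ (above α)))
      where
      above : ∀ α → Σ[ x ∈ A ] (x ∈ S × α < lo x)
      above = countable-fibres⇒unbounded lo unc fibres

-- Strictly increasing maps between finite ordinals

StrictlyIncreasing : ∀ {n} → (Fin n → ℕ) → Set
StrictlyIncreasing f = ∀ {i j} → i Fin.< j → f i ℕ.< f j

increasing⇒≥ : ∀ {n} (f : Fin n → ℕ) → StrictlyIncreasing f →
               ∀ c → (∀ i → c ℕ.≤ f i) → ∀ a → c + toℕ a ℕ.≤ f a
increasing⇒≥ f mono c c≤f zero    = subst (ℕ._≤ f zero) (sym (ℕ.+-identityʳ c)) (c≤f zero)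
increasing⇒≥ f mono c c≤f (suc a) = subst (ℕ._≤ f (suc a)) (sym (ℕ.+-suc c (toℕ a)))
  (increasing⇒≥ (f ∘ suc) (λ i<j → mono (s≤s i<j)) (suc c)
    (λ i → ℕ.≤-<-trans (c≤f zero) (mono (s≤s z≤n))) a)

-- This is f a ≤ M - (n - a) without subtraction: the n - a values from `f a` on must fit below `M`.
increasing⇒≤ : ∀ {n} (f : Fin n → ℕ) → StrictlyIncreasing f →
               ∀ M → (∀ i → f i ℕ.< M) → ∀ a → n + f a ℕ.≤ M + toℕ a
increasing⇒≤ {suc zero}    f mono M f<M zero = subst (suc (f zero) ℕ.≤_) (sym (ℕ.+-identityʳ M)) (f<M zero)
increasing⇒≤ {suc (suc n)} f mono M f<M zero = ℕ.≤-trans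
  (subst (ℕ._≤ suc n + f (suc zero)) (ℕ.+-suc (suc n) (f zero))
    (ℕ.+-monoʳ-≤ (suc n) (mono {zero} {suc zero} (s≤s z≤n))))
  (increasing⇒≤ (f ∘ suc) (λ i<j → mono (s≤s i<j)) M (f<M ∘ suc) zero)
increasing⇒≤ {suc n} f mono M f<M (suc a) = subst (suc n + f (suc a) ℕ.≤_) (sym (ℕ.+-suc M (toℕ a)))
  (s≤s (increasing⇒≤ (f ∘ suc) (λ i<j → mono (s≤s i<j)) M (f<M ∘ suc) a))

-- With c = 0 and M = n the two bounds meet. This rigidity lets indices be compared across two
-- members of a level.
increasing⇒id : ∀ {n} (f : Fin n → Fin n) → StrictlyIncreasing (toℕ ∘ f) →
                ∀ a → f a ≡ a
increasing⇒id {n} f mono a = Fin.toℕ-injective (ℕ.≤-antisym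
  (ℕ.+-cancelˡ-≤ n _ _ (increasing⇒≤ (toℕ ∘ f) mono n (λ i → Fin.toℕ<n (f i)) a))
  (increasing⇒≥ (toℕ ∘ f) mono 0 (λ _ → z≤n) a))

-- Finite subsets of ω₁

module FiniteSubsets (em : ∀ {ℓ} → ExcludedMiddle ℓ) (Ω : Omega₁) where

  open Omega₁ Ω
  open Classical em
  private module O = IsStrictTotalOrder isStrictTotalOrder

  <⇒≢ : ∀ {α β} → α < β → α ≢ β
  <⇒≢ α<β α≡β = O.irrefl α≡β α<β

  Increasing : ∀ {n} → Vec Ordinal n → Set
  Increasing xs = ∀ {i j} → i Fin.< j → lookup xs i < lookup xs j

  elements : ∀ {n} → [ Ω ]^ n → Vec Ordinal n
  elements = [_]^_.elements

  -- An irrelevant proof may only be used to reach absurdity, so the order is decided first and the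
  -- stored proof rules out the other two outcomes.
  ⟨⟩-increasing : ∀ {n} (X : [ Ω ]^ n) → Increasing (elements X)
  ⟨⟩-increasing (enum xs inc) {i} {j} i<j with O.compare (lookup xs i) (lookup xs j)
  ... | tri< lt _ _ = lt
  ... | tri≈ ≮ _ _  = ⊥-elim-irr (≮ (inc i<j))
  ... | tri> ≮ _ _  = ⊥-elim-irr (≮ (inc i<j))

  module _ {n : ℕ} (X : [ Ω ]^ n) where

    ⟨⟩-injective : ∀ {i j} → X ⟨ i ⟩ ≡ X ⟨ j ⟩ → i ≡ j
    ⟨⟩-injective {i} {j} eq with Fin.<-cmp i j
    ... | tri< lt _ _ = contradiction eq (<⇒≢ (⟨⟩-increasing X lt))
    ... | tri≈ _ e _  = e
    ... | tri> _ _ gt = contradiction (sym eq) (<⇒≢ (⟨⟩-increasing X gt))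

    ⟨⟩-reflects-< : ∀ {i j} → X ⟨ i ⟩ < X ⟨ j ⟩ → i Fin.< j
    ⟨⟩-reflects-< {i} {j} lt with Fin.<-cmp i j
    ... | tri< i<j _ _  = i<j
    ... | tri≈ _ refl _ = contradiction lt (O.irrefl refl)
    ... | tri> _ _ j<i  = contradiction lt (O.asym (⟨⟩-increasing X j<i))

    ⟨⟩-mono-≮ : ∀ {i j} → toℕ i ℕ.≤ toℕ j → ¬ X ⟨ j ⟩ < X ⟨ i ⟩
    ⟨⟩-mono-≮ i≤j lt = ℕ.<⇒≱ (⟨⟩-reflects-< lt) i≤j

  []^-ext : ∀ {n} (X Y : [ Ω ]^ n) → (∀ i → X ⟨ i ⟩ ≡ Y ⟨ i ⟩) → X ≡ Y
  []^-ext (enum xs p) (enum ys q) h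
    with trans (sym (Vec.tabulate∘lookup xs)) (trans (Vec.tabulate-cong h) (Vec.tabulate∘lookup ys))
  ... | refl = refl

  restrict : ∀ {t v} (π : Fin t → Fin v) → (∀ {i j} → i Fin.< j → π i Fin.< π j) →
             (X : [ Ω ]^ v) → Σ[ Y ∈ [ Ω ]^ t ] (∀ i → Y ⟨ i ⟩ ≡ X ⟨ π i ⟩)
  restrict {t} π mono X = enum (tabulate f) inc , Vec.lookup∘tabulate f
    where
    f : Fin t → Ordinal
    f i = X ⟨ π i ⟩

    inc : Increasing (tabulate f)
    inc {i} {j} i<j = subst₂ _<_ (sym (Vec.lookup∘tabulate f i)) (sym (Vec.lookup∘tabulate f j))
      (⟨⟩-increasing X (mono i<j))

  prefix : ∀ {k n} → k ℕ.≤ n → (X : [ Ω ]^ n) →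
    Σ[ R ∈ [ Ω ]^ k ] (∀ a b → toℕ a ≡ toℕ b → R ⟨ a ⟩ ≡ X ⟨ b ⟩)
  prefix k≤n X =
    proj₁ restricted ,
    λ a b eq → trans (proj₂ restricted a)
      (cong (λ i → X ⟨ i ⟩) (Fin.toℕ-injective (trans (Fin.toℕ-inject≤ a k≤n) eq)))
    where
    restricted = restrict (λ i → Fin.inject≤ i k≤n)
      (λ {i} {j} → subst₂ ℕ._<_ (sym (Fin.toℕ-inject≤ i k≤n)) (sym (Fin.toℕ-inject≤ j k≤n))) X

  private
    -- Since `ρ` occurs in `x ∷ xs`, the head `x` is at most `ρ`. It cannot be smaller: a later root
    -- element and a non-root element are both above `ρ`. So the heads agree, and the tails inherit
    -- the hypotheses.
    prefix-entries : ∀ {n r} (xs : Vec Ordinal n) (ρs : Vec Ordinal r) →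
      Increasing xs → Increasing ρs →
      (∀ b → ∃[ a ] lookup xs a ≡ lookup ρs b) →
      (∀ b a → ¬ (∃[ c ] lookup ρs c ≡ lookup xs a) → lookup ρs b < lookup xs a) →
      r ℕ.≤ n × (∀ a b → toℕ a ≡ toℕ b → lookup xs a ≡ lookup ρs b)
    prefix-entries xs       []       _     _     _  _     = z≤n , λ _ ()
    prefix-entries []       (ρ ∷ ρs) _     _     ⊆  _     with ⊆ zero
    ... | () , _
    prefix-entries (x ∷ xs) (ρ ∷ ρs) inc-x inc-ρ ⊆ below = s≤s (proj₁ rec) , entries
      where
      x-smallest : ∀ a → lookup (x ∷ xs) a ≡ ρ → x ≡ ρ
      x-smallest zero    eq = eq
      x-smallest (suc a) eq with em {P = ∃[ c ] lookup (ρ ∷ ρs) c ≡ x}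
      ... | yes (zero , e)  = sym e
      ... | yes (suc c , e) = contradiction (subst (ρ <_) e (inc-ρ {zero} {suc c} (s≤s z≤n)))
                                (O.asym (subst (x <_) eq (inc-x {zero} {suc a} (s≤s z≤n))))
      ... | no ∉            = contradiction (below zero zero ∉)
                                (O.asym (subst (x <_) eq (inc-x {zero} {suc a} (s≤s z≤n))))

      x≡ρ : x ≡ ρ
      x≡ρ = x-smallest (proj₁ (⊆ zero)) (proj₂ (⊆ zero))

      ⊆-tail : ∀ b → ∃[ a ] lookup xs a ≡ lookup ρs b
      ⊆-tail b with ⊆ (suc b)
      ... | zero  , e = contradiction (trans (sym x≡ρ) e) (<⇒≢ (inc-ρ {zero} {suc b} (s≤s z≤n)))
      ... | suc a , e = a , e

      below-tail : ∀ b a → ¬ (∃[ c ] lookup ρs c ≡ lookup xs a) → lookup ρs b < lookup xs a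
      below-tail b a ∉ = below (suc b) (suc a) λ
        { (zero , e)  → <⇒≢ (inc-x {zero} {suc a} (s≤s z≤n)) (trans x≡ρ e)
        ; (suc c , e) → ∉ (c , e) }

      rec = prefix-entries xs ρs (λ i<j → inc-x (s≤s i<j)) (λ i<j → inc-ρ (s≤s i<j)) ⊆-tail below-tail

      entries : ∀ a b → toℕ a ≡ toℕ b → lookup (x ∷ xs) a ≡ lookup (ρ ∷ ρs) b
      entries zero    zero    _  = x≡ρ
      entries (suc a) (suc b) eq = proj₂ rec a b (ℕ.suc-injective eq)

  module _ {n r : ℕ} (X : [ Ω ]^ n) (R : [ Ω ]^ r)
           (R⊆X : El R ⊆ El X) (R≺ : El R ≺ (El X ∖ El R)) where

    private
      both : r ℕ.≤ n × (∀ a b → toℕ a ≡ toℕ b → X ⟨ a ⟩ ≡ R ⟨ b ⟩)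
      both = prefix-entries (elements X) (elements R) (⟨⟩-increasing X) (⟨⟩-increasing R)
        (λ b → R⊆X (b , refl)) (λ b a ∉ → R≺ (b , refl) ((a , refl) , ∉))

    root-size : r ℕ.≤ n
    root-size = proj₁ both

    root-entry : ∀ a b → toℕ a ≡ toℕ b → X ⟨ a ⟩ ≡ R ⟨ b ⟩
    root-entry = proj₂ both

    <root⇒∈ : ∀ a → toℕ a ℕ.< r → X ⟨ a ⟩ ∈ El R
    <root⇒∈ a a<r = Fin.fromℕ< a<r , sym (root-entry a _ (sym (Fin.toℕ-fromℕ< a<r)))

    ≥root⇒∉ : ∀ a → r ℕ.≤ toℕ a → X ⟨ a ⟩ ∉ El R
    ≥root⇒∉ a r≤a (b , Rb≡Xa) = ℕ.<⇒≱ (Fin.toℕ<n b) (subst (r ℕ.≤_) (sym toℕb≡) r≤a)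
      where
      b′ : Fin n
      b′ = Fin.inject≤ b root-size

      toℕb≡ : toℕ b ≡ toℕ a
      toℕb≡ = trans (sym (Fin.toℕ-inject≤ b root-size)) (cong toℕ (⟨⟩-injective X
        (trans (root-entry b′ b (Fin.toℕ-inject≤ b root-size)) Rb≡Xa)))

    ∈⇒<root : ∀ a → X ⟨ a ⟩ ∈ El R → toℕ a ℕ.< r
    ∈⇒<root a a∈R = ℕ.≰⇒> λ r≤a → ≥root⇒∉ a r≤a a∈R

    ∉⇒≥root : ∀ a → X ⟨ a ⟩ ∉ El R → r ℕ.≤ toℕ a
    ∉⇒≥root a a∉R = ℕ.≮⇒≥ λ a<r → a∉R (<root⇒∈ a a<r)

  -- Either set is a root of the other with empty tail, so the order hypothesis of `root-size` holds
  -- vacuously in both directions.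
  size-unique : ∀ {n r} (X : [ Ω ]^ n) (Y : [ Ω ]^ r) → El X ≐ El Y → n ≡ r
  size-unique X Y (X⊆Y , Y⊆X) = ℕ.≤-antisym
    (root-size Y X X⊆Y λ _ (α∈Y , α∉X) → contradiction (Y⊆X α∈Y) α∉X)
    (root-size X Y Y⊆X λ _ (α∈X , α∉Y) → contradiction (X⊆Y α∈X) α∉Y)

  private
    insert : ∀ {n} (α : Ordinal) (xs : Vec Ordinal n) → Increasing xs →
      ∃[ m ] Σ[ ys ∈ Vec Ordinal m ] (Increasing ys ×
        (∃[ i ] lookup ys i ≡ α) ×
        (∀ j → ∃[ i ] lookup ys i ≡ lookup xs j) ×
        (∀ i → lookup ys i ≡ α ⊎ (∃[ j ] lookup ys i ≡ lookup xs j)))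
    insert α [] inc = 1 , α ∷ [] , (λ { {zero} {zero} () }) ,
      (zero , refl) , (λ ()) , λ { zero → inj₁ refl }
    insert {suc n} α (x ∷ xs) inc with O.compare α x
    ... | tri≈ _ refl _ = suc n , x ∷ xs , inc , (zero , refl) , (λ j → j , refl) , λ i → inj₂ (i , refl)
    ... | tri< α<x _ _  = suc (suc n) , α ∷ x ∷ xs , inc′ , (zero , refl) , (λ j → suc j , refl) ,
                          λ { zero → inj₁ refl ; (suc i) → inj₂ (i , refl) }
      where
      α< : ∀ j → α < lookup (x ∷ xs) j
      α< zero    = α<x
      α< (suc j) = O.trans α<x (inc {zero} {suc j} (s≤s z≤n))

      inc′ : Increasing (α ∷ x ∷ xs)
      inc′ {zero}  {suc j} _         = α< j
      inc′ {suc i} {suc j} (s≤s i<j) = inc i<j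
    ... | tri> _ _ x<α with insert α xs (λ i<j → inc (s≤s i<j))
    ...   | m , ys , inc-ys , (k , k≡) , xs⊆ , ys⊆ =
      suc m , x ∷ ys , inc′ , (suc k , k≡) , ⊇ , ⊆
      where
      x< : ∀ i → x < lookup ys i
      x< i with ys⊆ i
      ... | inj₁ e       = subst (x <_) (sym e) x<α
      ... | inj₂ (j , e) = subst (x <_) (sym e) (inc {zero} {suc j} (s≤s z≤n))

      inc′ : Increasing (x ∷ ys)
      inc′ {zero}  {suc j} _         = x< j
      inc′ {suc i} {suc j} (s≤s i<j) = inc-ys i<j

      ⊇ : ∀ j → ∃[ i ] lookup (x ∷ ys) i ≡ lookup (x ∷ xs) j
      ⊇ zero    = zero , refl
      ⊇ (suc j) = suc (proj₁ (xs⊆ j)) , proj₂ (xs⊆ j)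

      ⊆ : ∀ i → lookup (x ∷ ys) i ≡ α ⊎ (∃[ j ] lookup (x ∷ ys) i ≡ lookup (x ∷ xs) j)
      ⊆ zero    = inj₂ (zero , refl)
      ⊆ (suc i) with ys⊆ i
      ... | inj₁ e       = inj₁ e
      ... | inj₂ (j , e) = inj₂ (suc j , e)

  enumerate : (αs : List Ordinal) →
              Σ[ X ∈ FinSubset Ω ] (∀ {α} → α ∈ˡ αs → El (proj₂ X) α)
  enumerate []       = (0 , enum [] (λ { {()} })) , λ ()
  enumerate (α ∷ αs) with enumerate αs
  ... | (n , X) , αs⊆X with insert α (elements X) (⟨⟩-increasing X)
  ...   | m , ys , inc , α∈ , X⊆ , _ = (m , enum ys inc) ,
    λ { (here refl) → α∈
      ; (there α∈αs) → let j , e = αs⊆X α∈αs in proj₁ (X⊆ j) , trans (proj₂ (X⊆ j)) e }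

-- Construction schemes

module Schemes (em : ∀ {ℓ} → ExcludedMiddle ℓ) {Ω : Omega₁} {τ : SchemeType}
               (S : ConstructionScheme Ω τ) where

  open Omega₁ Ω
  open SchemeType τ
  open ConstructionScheme S
  open Classical em
  open FiniteSubsets em Ω
  private module O = IsStrictTotalOrder isStrictTotalOrder

  -- The scheme states coherence within one level. When `E` has a lower level, `α` lies in a piece
  -- of `F`, and by induction `ξ` lies in the same piece.
  ∩-initial : ∀ {j k} → j ℕ.≤′ k → (E : [ Ω ]^ m j) (F : [ Ω ]^ m k) →
    E ∈ Level-member τ 𝓕 j → F ∈ Level-member τ 𝓕 k →
    ∀ {ξ α} → ξ ∈ El E → α ∈ El E → α ∈ El F → ξ < α → ξ ∈ El F
  ∩-initial {j} ℕ.≤′-refl E F E∈ F∈ ξ∈E α∈E α∈F ξ<α =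
    proj₂ (proj₂ (proj₁ (intersections j E F E∈ F∈)) ξ∈E (α∈E , α∈F) ξ<α)
  ∩-initial {j} {suc k} (ℕ.≤′-step j≤k) E F E∈ F∈ ξ∈E α∈E α∈F ξ<α =
    let G , R , dec = decomposes k F F∈
        open Decomposition dec
        i , α∈Gi = proj₁ union α∈F
    in proj₂ union (i , ∩-initial j≤k E (G i) E∈ (members i) ξ∈E α∈E α∈Gi ξ<α)

  descend : ∀ {j k} → j ℕ.≤′ k → (F : [ Ω ]^ m k) → F ∈ Level-member τ 𝓕 k →
    ∀ {α} → α ∈ El F → Σ[ E ∈ [ Ω ]^ m j ] (E ∈ Level-member τ 𝓕 j × α ∈ El E)
  descend ℕ.≤′-refl F F∈ α∈F = F , F∈ , α∈F
  descend {j} {suc k} (ℕ.≤′-step j≤k) F F∈ α∈F =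
    let G , R , dec = decomposes k F F∈
        open Decomposition dec
        i , α∈Gi = proj₁ union α∈F
    in descend j≤k (G i) (members i) α∈Gi

  private
    minimum : (P : Pred ℕ 0ℓ) → ∀ k →
      (∃[ j ] (j ℕ.< k × P j × (∀ i → P i → j ℕ.≤ i))) ⊎ (∀ i → i ℕ.< k → ¬ P i)
    minimum P zero = inj₂ λ i ()
    minimum P (suc k) with minimum P k
    ... | inj₁ (j , j<k , rest) = inj₁ (j , ℕ.m<n⇒m<1+n j<k , rest)
    ... | inj₂ none with em {P = P k}
    ...   | yes pk = inj₁ (k , ℕ.n<1+n k , pk , λ i pi → ℕ.≮⇒≥ λ i<k → none i i<k pi)
    ...   | no ¬pk = inj₂ λ i i<1+k pi → case-≤ i pi (ℕ.m≤n⇒m<n∨m≡n (ℕ.≤-pred i<1+k))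
      where
      case-≤ : ∀ i → P i → i ℕ.< k ⊎ i ≡ k → ⊥
      case-≤ i pi (inj₁ i<k)  = none i i<k pi
      case-≤ i pi (inj₂ refl) = ¬pk pi

  CommonMember⇒ρ≤ : ∀ {α β k} → CommonMember S α β k →
                    ∃[ j ] (ρ[_,_]≡_ S α β j × j ℕ.≤ k)
  CommonMember⇒ρ≤ {α} {β} {k} common with minimum (CommonMember S α β) (suc k)
  ... | inj₁ (j , j<1+k , pj , least) = j , (pj , least) , ℕ.≤-pred j<1+k
  ... | inj₂ none                     = contradiction common (none k (ℕ.n<1+n k))

  -- For ξ below α in `F`, `F` itself witnesses ρ(α,ξ) ≤ k. Conversely, a witness of level j ≤ k
  -- meets `F` in an initial segment of itself, so ξ belongs to `F`.
  index≡‖‖ : ∀ {k} (F : [ Ω ]^ m k) → F ∈ Level-member τ 𝓕 k →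
             ∀ i → ‖_‖[_]≡_ S (F ⟨ i ⟩) k (toℕ i)
  index≡‖‖ {k} F F∈ i = X , below , above
    where
    i≤m : toℕ i ℕ.≤ m k
    i≤m = ℕ.<⇒≤ (Fin.toℕ<n i)

    X : [ Ω ]^ toℕ i
    X = proj₁ (prefix i≤m F)

    below : ∀ {ξ} → ξ ∈ El X → _
    below {ξ} (a , Xa≡ξ) = subst (_< F ⟨ i ⟩) Fb≡ξ (⟨⟩-increasing F b<i) ,
      CommonMember⇒ρ≤ (F , F∈ , (i , refl) , (b , Fb≡ξ))
      where
      b : Fin (m k)
      b = Fin.inject≤ a i≤m

      b<i : b Fin.< i
      b<i = subst (ℕ._< toℕ i) (sym (Fin.toℕ-inject≤ a i≤m)) (Fin.toℕ<n a)

      Fb≡ξ : F ⟨ b ⟩ ≡ ξ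
      Fb≡ξ = trans (sym (proj₂ (prefix i≤m F) a b (sym (Fin.toℕ-inject≤ a i≤m)))) Xa≡ξ

    above : ∀ {ξ} → (ξ < F ⟨ i ⟩ × (∃[ j ] (ρ[_,_]≡_ S (F ⟨ i ⟩) ξ j × j ℕ.≤ k))) → ξ ∈ El X
    above {ξ} (ξ<α , j , ((E , E∈ , α∈E , ξ∈E) , _) , j≤k)
      with ∩-initial (ℕ.≤⇒≤′ j≤k) E F E∈ F∈ ξ∈E α∈E (i , refl) ξ<α
    ... | b , Fb≡ξ = Fin.fromℕ< b<i ,
      trans (proj₂ (prefix i≤m F) _ b (Fin.toℕ-fromℕ< b<i)) Fb≡ξ
      where
      b<i : b Fin.< i
      b<i = ⟨⟩-reflects-< F (subst (_< F ⟨ i ⟩) (sym Fb≡ξ) ξ<α)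

  ‖‖-unique : ∀ {α k a b} → ‖_‖[_]≡_ S α k a → ‖_‖[_]≡_ S α k b → a ≡ b
  ‖‖-unique (X , X⊆ , ⊆X) (Y , Y⊆ , ⊆Y) =
    size-unique X Y ((λ p → ⊆Y (X⊆ p)) , (λ p → ⊆X (Y⊆ p)))

  private
    another : ∀ {n} → 2 ℕ.≤ n → (i : Fin n) → ∃[ j ] i ≢ j
    another (s≤s (s≤s _)) zero    = suc zero , λ ()
    another (s≤s (s≤s _)) (suc i) = zero , λ ()

  module DecompositionProperties {k : ℕ} {F : [ Ω ]^ m (suc k)} {G : Fin (n₊ k) → [ Ω ]^ m k}
    {R : [ Ω ]^ r₊ k} (dec : Decomposition τ 𝓕 F G R) where

    open Decomposition dec public

    R⊆G : ∀ i → El R ⊆ El (G i)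
    -- `Δ-system` speaks of two different pieces; `2≤n₊` provides the second.
    R⊆G i α∈R = let j , i≢j = another (2≤n₊ k) i in
      proj₁ (proj₂ (proj₂ (Δ-system i j i≢j)) α∈R)

    G-<root⇒∈ : ∀ i a → toℕ a ℕ.< r₊ k → G i ⟨ a ⟩ ∈ El R
    G-<root⇒∈ i = <root⇒∈ (G i) R (R⊆G i) (root-below i)

    G-≥root⇒∉ : ∀ i a → r₊ k ℕ.≤ toℕ a → G i ⟨ a ⟩ ∉ El R
    G-≥root⇒∉ i = ≥root⇒∉ (G i) R (R⊆G i) (root-below i)

    G-<root⇒≡ : ∀ i j a → toℕ a ℕ.< r₊ k → G i ⟨ a ⟩ ≡ G j ⟨ a ⟩
    G-<root⇒≡ i j a a<r = trans (entry i) (sym (entry j))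
      where
      entry : ∀ i → G i ⟨ a ⟩ ≡ R ⟨ Fin.fromℕ< a<r ⟩
      entry i = root-entry (G i) R (R⊆G i) (root-below i) a _ (sym (Fin.toℕ-fromℕ< a<r))

    tail : ∀ i a → r₊ k ℕ.≤ toℕ a → G i ⟨ a ⟩ ∈ (El (G i) ∖ El R)
    tail i a r≤a = (a , refl) , G-≥root⇒∉ i a r≤a

    tails-disjoint : ∀ i j {α} → α ∈ El (G i) → α ∈ El (G j) → α ∉ El R → i ≡ j
    tails-disjoint i j α∈Gi α∈Gj α∉R with i Fin.≟ j
    ... | yes i≡j = i≡j
    ... | no  i≢j = contradiction (proj₁ (proj₂ (Δ-system i j i≢j)) (α∈Gi , α∈Gj)) α∉R

  -- Any two members of one level are isomorphic as decomposed ordered sets.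
  module _ {k : ℕ} {F F′ : [ Ω ]^ m (suc k)} {G G′ : Fin (n₊ k) → [ Ω ]^ m k} {R R′ : [ Ω ]^ r₊ k}
           (dec : Decomposition τ 𝓕 F G R) (dec′ : Decomposition τ 𝓕 F′ G′ R′) where

    private
      module D  = DecompositionProperties dec
      module D′ = DecompositionProperties dec′

      -- The order of two entries depends only on their pieces and positions: root entries are
      -- common to all pieces and precede every tail, tails are ordered by piece, and inside one
      -- piece the position decides.
      transfer-< : ∀ t q u w → G t ⟨ q ⟩ < G u ⟨ w ⟩ → G′ t ⟨ q ⟩ < G′ u ⟨ w ⟩
      transfer-< t q u w lt with toℕ q ℕ.<? r₊ k | toℕ w ℕ.<? r₊ k
      ... | yes q<r | yes w<r = subst (_< G′ u ⟨ w ⟩) (D′.G-<root⇒≡ u t q q<r)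
        (⟨⟩-increasing (G′ u) (⟨⟩-reflects-< (G u) (subst (_< G u ⟨ w ⟩) (D.G-<root⇒≡ t u q q<r) lt)))
      ... | yes q<r | no w≮r = D′.root-below u (D′.G-<root⇒∈ t q q<r) (D′.tail u w (ℕ.≮⇒≥ w≮r))
      ... | no q≮r  | yes w<r = contradiction lt
        (O.asym (D.root-below t (D.G-<root⇒∈ u w w<r) (D.tail t q (ℕ.≮⇒≥ q≮r))))
      ... | no q≮r  | no w≮r with Fin.<-cmp t u
      ...   | tri< t<u _ _  = D′.tails t u t<u (D′.tail t q (ℕ.≮⇒≥ q≮r)) (D′.tail u w (ℕ.≮⇒≥ w≮r))
      ...   | tri≈ _ refl _ = ⟨⟩-increasing (G′ t) (⟨⟩-reflects-< (G t) lt)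
      ...   | tri> _ _ u<t  = contradiction lt
        (O.asym (D.tails u t u<t (D.tail u w (ℕ.≮⇒≥ w≮r)) (D.tail t q (ℕ.≮⇒≥ q≮r))))

      part : Fin (m (suc k)) → Fin (n₊ k)
      part a = proj₁ (proj₁ D.union (a , refl))

      position : Fin (m (suc k)) → Fin (m k)
      position a = proj₁ (proj₂ (proj₁ D.union (a , refl)))

      G-position : ∀ a → G (part a) ⟨ position a ⟩ ≡ F ⟨ a ⟩
      G-position a = proj₂ (proj₂ (proj₁ D.union (a , refl)))

      image : ∀ a → G′ (part a) ⟨ position a ⟩ ∈ El F′
      image a = proj₂ D′.union (part a , position a , refl)

      -- Matching equal pieces and positions of `F` and `F′` induces a strictly increasing map of a
      -- finite order into itself.
      image-id : ∀ a → proj₁ (image a) ≡ a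
      image-id = increasing⇒id (λ a → proj₁ (image a)) λ {a} {b} a<b → ⟨⟩-reflects-< F′
        (subst₂ _<_ (sym (proj₂ (image a))) (sym (proj₂ (image b)))
          (transfer-< (part a) (position a) (part b) (position b)
            (subst₂ _<_ (sym (G-position a)) (sym (G-position b)) (⟨⟩-increasing F a<b))))

      G′-position : ∀ a → G′ (part a) ⟨ position a ⟩ ≡ F′ ⟨ a ⟩
      G′-position a = trans (sym (proj₂ (image a))) (cong (λ b → F′ ⟨ b ⟩) (image-id a))

    transfer-root : ∀ a → F ⟨ a ⟩ ∈ El R → F′ ⟨ a ⟩ ∈ El R′
    transfer-root a a∈R = subst (_∈ El R′) (G′-position a) (D′.G-<root⇒∈ (part a) (position a)
      (∈⇒<root (G (part a)) R (D.R⊆G (part a)) (D.root-below (part a)) (position a)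
        (subst (_∈ El R) (sym (G-position a)) a∈R)))

    transfer-tail : ∀ a i → F ⟨ a ⟩ ∈ (El (G i) ∖ El R) → F′ ⟨ a ⟩ ∈ (El (G′ i) ∖ El R′)
    transfer-tail a i (a∈Gi , a∉R) =
      (position a , trans (cong (λ t → G′ t ⟨ position a ⟩) (sym part≡i)) (G′-position a)) ,
      subst (_∉ El R′) (G′-position a) (D′.G-≥root⇒∉ (part a) (position a)
        (∉⇒≥root (G (part a)) R (D.R⊆G (part a)) (D.root-below (part a)) (position a)
          (subst (_∉ El R) (sym (G-position a)) a∉R)))
      where
      part≡i : part a ≡ i
      part≡i = D.tails-disjoint (part a) i (position a , G-position a) a∈Gi a∉R

  -- By `index≡‖‖`, equal norms put α and β at the same index in members of level l, and the
  -- isomorphism of their decompositions carries the piece of α to that of β.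
  Ξ-determined : ∀ l {α β v c} → Ξ[_,_]≡_ S α l v →
    ‖_‖[_]≡_ S α l c → ‖_‖[_]≡_ S β l c →
    Σ[ F ∈ [ Ω ]^ m l ] (F ∈ Level-member τ 𝓕 l × β ∈ El F) → Ξ[_,_]≡_ S β l v
  Ξ-determined zero    Ξα _ _ _ = Ξα
  Ξ-determined (suc k) {v = v} (F , F∈ , (i , refl) , G , R , dec , value) ‖α‖ ‖β‖ (F′ , F′∈ , (i′ , refl))
    with Fin.toℕ-injective (trans (‖‖-unique (index≡‖‖ F F∈ i) ‖α‖) (‖‖-unique ‖β‖ (index≡‖‖ F′ F′∈ i′)))
  ... | refl with decomposes k F′ F′∈
  ...   | G′ , R′ , dec′ = F′ , F′∈ , (i , refl) , G′ , R′ , dec′ , transfer value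
    where
    transfer : (F ⟨ i ⟩ ∈ El R × v ≡ -1ℤ) ⊎ (∃[ j ] (F ⟨ i ⟩ ∈ (El (G j) ∖ El R) × v ≡ + toℕ j)) →
               (F′ ⟨ i ⟩ ∈ El R′ × v ≡ -1ℤ) ⊎ (∃[ j ] (F′ ⟨ i ⟩ ∈ (El (G′ j) ∖ El R′) × v ≡ + toℕ j))
    transfer (inj₁ (∈R , v≡))     = inj₁ (transfer-root dec dec′ i ∈R , v≡)
    transfer (inj₂ (j , ∈G , v≡)) = inj₂ (j , transfer-tail dec dec′ i j ∈G , v≡)

-- Captured pairs

-- Supplies the root size of a subpair: the indices of `E` that fall into the root of `D` form an
-- initial segment.
downward-closed⇒cut : ∀ {t} (P : Fin t → Set) → (∀ i → Dec (P i)) →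
  (∀ {i j} → i Fin.< j → P j → P i) →
  ∃[ k ] (k ℕ.≤ t × (∀ i → toℕ i ℕ.< k → P i) × (∀ i → P i → toℕ i ℕ.< k))
downward-closed⇒cut {zero}  P P? down = 0 , z≤n , (λ ()) , λ ()
downward-closed⇒cut {suc t} P P? down with P? zero
... | no ¬p0 = 0 , z≤n , (λ _ ()) , λ
  { zero p → contradiction p ¬p0 ; (suc i) p → contradiction (down (s≤s z≤n) p) ¬p0 }
... | yes p0 with downward-closed⇒cut (P ∘ suc) (P? ∘ suc) (λ i<j → down (s≤s i<j))
...   | k , k≤t , below , above = suc k , s≤s k≤t ,
  (λ { zero _ → p0 ; (suc i) (s≤s i<k) → below i i<k }) ,
  (λ { zero _ → s≤s z≤n ; (suc i) p → s≤s (above i p) })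

module Captures (em : ∀ {ℓ} → ExcludedMiddle ℓ) {Ω : Omega₁} {τ : SchemeType}
                (S : ConstructionScheme Ω τ) where

  open Omega₁ Ω
  open Classical em
  open FiniteSubsets em Ω
  open Schemes em S
  private module O = IsStrictTotalOrder isStrictTotalOrder

  pattern one = suc zero

  ⟦_,_⟧ : {A : Set} → A → A → Fin 2 → A
  ⟦ x , y ⟧ zero = x
  ⟦ x , y ⟧ one  = y

  ΔSystem-pair : ∀ {s r} (D : Fin 2 → [ Ω ]^ s) (R : [ Ω ]^ r) → D zero ≢ D one →
    (∀ {α} → α ∈ El (D zero) → α ∈ El (D one) → α ∈ El R) →
    (∀ j → El R ⊆ El (D j)) → IsΔSystem D R
  ΔSystem-pair D R D≢ ⊆R R⊆ zero zero i≢j = contradiction refl i≢j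
  ΔSystem-pair D R D≢ ⊆R R⊆ zero one  i≢j =
    D≢ , (λ (p , q) → ⊆R p q) , λ p → R⊆ zero p , R⊆ one p
  ΔSystem-pair D R D≢ ⊆R R⊆ one  zero i≢j =
    D≢ ∘ sym , (λ (p , q) → ⊆R q p) , λ p → R⊆ one p , R⊆ zero p
  ΔSystem-pair D R D≢ ⊆R R⊆ one  one  i≢j = contradiction refl i≢j

  0≢1 : _≢_ {A = Fin 2} zero one
  0≢1 ()

  ΔSystem⇒∩⊆ : ∀ {s r} (D : Fin 2 → [ Ω ]^ s) (R : [ Ω ]^ r) → IsΔSystem D R →
    ∀ {α} → α ∈ El (D zero) → α ∈ El (D one) → α ∈ El R
  ΔSystem⇒∩⊆ D R Δ p q = proj₁ (proj₂ (Δ zero one 0≢1)) (p , q)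

  ΔSystem⇒R⊆ : ∀ {s r} (D : Fin 2 → [ Ω ]^ s) (R : [ Ω ]^ r) → IsΔSystem D R →
    ∀ j → El R ⊆ El (D j)
  ΔSystem⇒R⊆ D R Δ zero p = proj₁ (proj₂ (proj₂ (Δ zero one 0≢1)) p)
  ΔSystem⇒R⊆ D R Δ one  p = proj₂ (proj₂ (proj₂ (Δ zero one 0≢1)) p)

  module CapturedProperties {v l : ℕ} {D : Fin 2 → [ Ω ]^ v} (cap : ΔCaptured S D l) where

    open ΔCaptured cap public

    R⊆ : ∀ j → El R ⊆ El (D j)
    R⊆ = ΔSystem⇒R⊆ D R Δ-system

    D-≥root⇒∉ : ∀ j a → r ℕ.≤ toℕ a → D j ⟨ a ⟩ ∉ El R
    D-≥root⇒∉ j = ≥root⇒∉ (D j) R (R⊆ j) (root-below j)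

    D-∈⇒<root : ∀ j a → D j ⟨ a ⟩ ∈ El R → toℕ a ℕ.< r
    D-∈⇒<root j = ∈⇒<root (D j) R (R⊆ j) (root-below j)

    D-<root⇒≡ : ∀ i j a → toℕ a ℕ.< r → D i ⟨ a ⟩ ≡ D j ⟨ a ⟩
    D-<root⇒≡ i j a a<r = trans (entry i) (sym (entry j))
      where
      entry : ∀ i → D i ⟨ a ⟩ ≡ R ⟨ Fin.fromℕ< a<r ⟩
      entry i = root-entry (D i) R (R⊆ i) (root-below i) a _ (sym (Fin.toℕ-fromℕ< a<r))

  module _ {v t l : ℕ} {D : Fin 2 → [ Ω ]^ v} (cap : ΔCaptured S D l)
           (E : Fin 2 → [ Ω ]^ t) (π : Fin t → Fin v)
           (E≡ : ∀ j i → E j ⟨ i ⟩ ≡ D j ⟨ π i ⟩) (E≢ : E zero ≢ E one) where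

    private
      module C = CapturedProperties cap

      π-increasing : ∀ {i j} → i Fin.< j → π i Fin.< π j
      π-increasing i<j = ⟨⟩-reflects-< (D zero)
        (subst₂ _<_ (E≡ zero _) (E≡ zero _) (⟨⟩-increasing (E zero) i<j))

      cut : ∃[ k ] (k ℕ.≤ t × (∀ i → toℕ i ℕ.< k → toℕ (π i) ℕ.< C.r) ×
                              (∀ i → toℕ (π i) ℕ.< C.r → toℕ i ℕ.< k))
      cut = downward-closed⇒cut (λ i → toℕ (π i) ℕ.< C.r) (λ i → toℕ (π i) ℕ.<? C.r)
        (λ i<j πj<r → ℕ.<-trans (π-increasing i<j) πj<r)

      k : ℕ
      k = proj₁ cut

      k≤t : k ℕ.≤ t
      k≤t = proj₁ (proj₂ cut)

      <k⇒ : ∀ i → toℕ i ℕ.< k → toℕ (π i) ℕ.< C.r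
      <k⇒ = proj₁ (proj₂ (proj₂ cut))

      ⇒<k : ∀ i → toℕ (π i) ℕ.< C.r → toℕ i ℕ.< k
      ⇒<k = proj₂ (proj₂ (proj₂ cut))

      ≥k⇒ : ∀ i → k ℕ.≤ toℕ i → C.r ℕ.≤ toℕ (π i)
      ≥k⇒ i k≤i = ℕ.≮⇒≥ λ πi<r → ℕ.<⇒≱ (⇒<k i πi<r) k≤i

      Q : [ Ω ]^ k
      Q = proj₁ (prefix k≤t (E zero))

      Q-entry : ∀ j b → E j ⟨ Fin.inject≤ b k≤t ⟩ ≡ Q ⟨ b ⟩
      Q-entry j b = trans (trans (E≡ j a) (trans (C.D-<root⇒≡ j zero (π a) (<k⇒ a a<k)) (sym (E≡ zero a))))
                          (sym (proj₂ (prefix k≤t (E zero)) b a (sym (Fin.toℕ-inject≤ b k≤t))))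
        where
        a : Fin t
        a = Fin.inject≤ b k≤t

        a<k : toℕ a ℕ.< k
        a<k = subst (ℕ._< k) (sym (Fin.toℕ-inject≤ b k≤t)) (Fin.toℕ<n b)

      Q⊆ : ∀ j → El Q ⊆ El (E j)
      Q⊆ j (b , refl) = Fin.inject≤ b k≤t , Q-entry j b

      <k⇒∈Q : ∀ j a → toℕ a ℕ.< k → E j ⟨ a ⟩ ∈ El Q
      <k⇒∈Q j a a<k = b , trans (sym (Q-entry j b))
        (cong (λ i → E j ⟨ i ⟩) (Fin.toℕ-injective (trans (Fin.toℕ-inject≤ b k≤t) (Fin.toℕ-fromℕ< a<k))))
        where
        b : Fin k
        b = Fin.fromℕ< a<k

      ∉Q⇒≥k : ∀ j a → E j ⟨ a ⟩ ∉ El Q → k ℕ.≤ toℕ a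
      ∉Q⇒≥k j a ∉Q = ℕ.≮⇒≥ λ a<k → ∉Q (<k⇒∈Q j a a<k)

      tail⇒tail : ∀ j {α} → α ∈ (El (E j) ∖ El Q) → α ∈ (El (D j) ∖ El C.R)
      tail⇒tail j ((a , refl) , ∉Q) = (π a , sym (E≡ j a)) ,
        subst (_∉ El C.R) (sym (E≡ j a)) (C.D-≥root⇒∉ j (π a) (≥k⇒ a (∉Q⇒≥k j a ∉Q)))

      ∩⊆Q : ∀ {α} → α ∈ El (E zero) → α ∈ El (E one) → α ∈ El Q
      ∩⊆Q (a , refl) (b , Eb≡Ea) = <k⇒∈Q zero a (⇒<k a (C.D-∈⇒<root zero (π a)
        (ΔSystem⇒∩⊆ D C.R C.Δ-system (π a , refl) (π b , trans (sym (E≡ one b)) (trans Eb≡Ea (E≡ zero a))))))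

      below : ∀ j → El Q ≺ (El (E j) ∖ El Q)
      below j (b , refl) ((a , refl) , ∉Q) = subst (_< E j ⟨ a ⟩) (Q-entry j b)
        (⟨⟩-increasing (E j) (ℕ.<-≤-trans
          (subst (ℕ._< k) (sym (Fin.toℕ-inject≤ b k≤t)) (Fin.toℕ<n b)) (∉Q⇒≥k j a ∉Q)))

    -- The new root is the part of `E` inside the old one, and tails go into tails. `Ξ` and `Δ` are
    -- prescribed entry by entry, and the same `π` serves both sets. Distinctness is assumed since
    -- both sets might fall into the old root.
    corresponding-captured : ΔCaptured S E l
    corresponding-captured = record
      { r          = k
      ; R          = Q
      ; Δ-system   = ΔSystem-pair E Q E≢ ∩⊆Q Q⊆
      ; root-below = below
      ; comparable = Sum.map (λ ≺ p q → ≺ (tail⇒tail zero p) (tail⇒tail one q))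
                             (λ ≺ p q → ≺ (tail⇒tail one p) (tail⇒tail zero q)) C.comparable
      ; Ξ-root     = λ j a a<k → subst (λ α → Ξ[_,_]≡_ S α l -1ℤ) (sym (E≡ j a))
                       (C.Ξ-root j (π a) (<k⇒ a a<k))
      ; Ξ-tail     = λ j a k≤a → subst (λ α → Ξ[_,_]≡_ S α l (+ toℕ j)) (sym (E≡ j a))
                       (C.Ξ-tail j (π a) (≥k⇒ a k≤a))
      ; Δ-tail     = λ a k≤a → subst₂ (λ α β → Δ[_,_]≡_ S α β l) (sym (E≡ zero a)) (sym (E≡ one a))
                       (C.Δ-tail (π a) (≥k⇒ a k≤a))
      }

  -- Replacing the elements of a pair by twins preserves being captured at level l.
  Twins : ℕ → Ordinal → Ordinal → Set
  Twins l α β = (∀ k → k ℕ.≤ l → ∀ c → ‖_‖[_]≡_ S α k c → ‖_‖[_]≡_ S β k c) ×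
                (∀ v → Ξ[_,_]≡_ S α l v → Ξ[_,_]≡_ S β l v)

  Twins-refl : ∀ {l α} → Twins l α α
  Twins-refl = (λ _ _ _ p → p) , (λ _ p → p)

  -- Root entries coincide. On the tail, Δ = l includes agreement of the norms below l, which
  -- `Ξ-determined` turns into agreement of `Ξ`.
  captured⇒Twins : ∀ {s l l′} {D : Fin 2 → [ Ω ]^ s} → ΔCaptured S D l → l′ ℕ.< l →
                   ∀ a → Twins l′ (D zero ⟨ a ⟩) (D one ⟨ a ⟩)
  -- As l′ < l, the level is a successor, so `Ξ-tail` unfolds to a member of 𝓕, from which `descend`
  -- obtains one of level l′.
  captured⇒Twins {s} {suc l₀} {l′} {D} cap l′<l a with toℕ a ℕ.<? ΔCaptured.r cap
  ... | yes a<r = subst (Twins l′ (D zero ⟨ a ⟩)) (D-<root⇒≡ zero one a a<r) Twins-refl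
    where open CapturedProperties cap
  ... | no  a≮r = norms , Ξs
    where
    open CapturedProperties cap

    agree : ∀ k → k ℕ.< suc l₀ →
            ∃[ c ] (‖_‖[_]≡_ S (D zero ⟨ a ⟩) k c × ‖_‖[_]≡_ S (D one ⟨ a ⟩) k c)
    agree = proj₂ (Δ-tail a (ℕ.≮⇒≥ a≮r))

    norms : ∀ k → k ℕ.≤ l′ → ∀ c → ‖_‖[_]≡_ S (D zero ⟨ a ⟩) k c → ‖_‖[_]≡_ S (D one ⟨ a ⟩) k c
    norms k k≤l′ c ‖α‖ =
      let d , ‖α‖′ , ‖β‖ = agree k (ℕ.≤-<-trans k≤l′ l′<l)
      in subst (‖_‖[_]≡_ S (D one ⟨ a ⟩) k) (‖‖-unique ‖α‖′ ‖α‖) ‖β‖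

    Ξs : ∀ v → Ξ[_,_]≡_ S (D zero ⟨ a ⟩) l′ v → Ξ[_,_]≡_ S (D one ⟨ a ⟩) l′ v
    Ξs v Ξα =
      let d , ‖α‖ , ‖β‖ = agree l′ l′<l
          F , F∈ , β∈F , _ = Ξ-tail one a (ℕ.≮⇒≥ a≮r)
      in Ξ-determined l′ Ξα ‖α‖ ‖β‖ (descend (ℕ.≤⇒≤′ (ℕ.<⇒≤ l′<l)) F F∈ β∈F)

  record UniformΔSystem {s : ℕ} (T : Pred ([ Ω ]^ s) 0ℓ) : Set where
    field
      r          : ℕ
      R          : [ Ω ]^ r
      Δ-system   : ∀ (D : Fin 2 → [ Ω ]^ s) → (∀ j → D j ∈ T) → D zero ≢ D one → IsΔSystem D R
      root-below : ∀ X → X ∈ T → El R ≺ (El X ∖ El R)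
      comparable : ∀ X Y → X ∈ T → Y ∈ T → X ≢ Y →
                   ((El X ∖ El R) ≺ (El Y ∖ El R)) ⊎ ((El Y ∖ El R) ≺ (El X ∖ El R))

  module _ {s : ℕ} {T : Pred ([ Ω ]^ s) 0ℓ} (U : UniformΔSystem T) where

    private module U = UniformΔSystem U

    Twins-captured : ∀ {l} (D E : Fin 2 → [ Ω ]^ s) → (∀ j → D j ∈ T) → (∀ j → E j ∈ T) →
      ΔCaptured S D l → E zero ≢ E one → (∀ j a → Twins l (D j ⟨ a ⟩) (E j ⟨ a ⟩)) →
      ΔCaptured S E l
    Twins-captured {l} D E D∈ E∈ cap E≢ twins = record
      { r          = U.r
      ; R          = U.R
      ; Δ-system   = U.Δ-system E E∈ E≢
      ; root-below = λ j → U.root-below (E j) (E∈ j)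
      ; comparable = U.comparable (E zero) (E one) (E∈ zero) (E∈ one) E≢
      ; Ξ-root     = λ j a a<r → proj₂ (twins j a) _ (C.Ξ-root j a (subst (toℕ a ℕ.<_) r≡ a<r))
      ; Ξ-tail     = λ j a r≤a → proj₂ (twins j a) _ (C.Ξ-tail j a (subst (ℕ._≤ toℕ a) r≡ r≤a))
      ; Δ-tail     = λ a r≤a →
          let (x , y , ‖α‖ , ‖β‖ , x≢y) , agree = C.Δ-tail a (subst (ℕ._≤ toℕ a) r≡ r≤a)
          in (x , y , proj₁ (twins zero a) l ℕ.≤-refl x ‖α‖ , proj₁ (twins one a) l ℕ.≤-refl y ‖β‖ , x≢y) ,
             λ k k<l → let c , ‖α‖ₖ , ‖β‖ₖ = agree k k<l in
               c , proj₁ (twins zero a) k (ℕ.<⇒≤ k<l) c ‖α‖ₖ , proj₁ (twins one a) k (ℕ.<⇒≤ k<l) c ‖β‖ₖ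
      }
      where
      module C = CapturedProperties cap

      Δ : IsΔSystem D U.R
      Δ = U.Δ-system D D∈ (proj₁ (C.Δ-system zero one 0≢1))

      -- Both roots are the intersection of the two sets, so the thresholds between root and tail
      -- indices agree.
      r≡ : U.r ≡ C.r
      r≡ = size-unique U.R C.R
        ( (λ p → ΔSystem⇒∩⊆ D C.R C.Δ-system (ΔSystem⇒R⊆ D U.R Δ zero p) (ΔSystem⇒R⊆ D U.R Δ one p))
        , (λ p → ΔSystem⇒∩⊆ D U.R Δ (C.R⊆ zero p) (C.R⊆ one p)) )

  module _ {s : ℕ} (N : ℕ) where

    -- Capture is ordered, because `Ξ` on a tail equals the index of the set in the pair; either
    -- order counts as a link.
    CapturedAt : ℕ → [ Ω ]^ s → [ Ω ]^ s → Set
    CapturedAt l X Y = N ℕ.≤ l × (ΔCaptured S ⟦ X , Y ⟧ l ⊎ ΔCaptured S ⟦ Y , X ⟧ l)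

    Linked : [ Ω ]^ s → [ Ω ]^ s → Set
    Linked X Y = X ≡ Y ⊎ (∃[ l ] CapturedAt l X Y)

    LinkedBelow : ℕ → [ Ω ]^ s → [ Ω ]^ s → Set
    LinkedBelow L X Y = X ≡ Y ⊎ (∃[ l ] (l ℕ.< L × CapturedAt l X Y))

    Linked-sym : ∀ {X Y} → Linked X Y → Linked Y X
    Linked-sym (inj₁ X≡Y)             = inj₁ (sym X≡Y)
    Linked-sym (inj₂ (l , N≤l , cap)) = inj₂ (l , N≤l , Sum.swap cap)

    -- `Y′` is the counterpart of `Y` in another condition. If X = Y, the new level l links them;
    -- otherwise the old level l′ < L ≤ l is kept, since `Y` and `Y′` are equal or twins at l′.
    amalgamate : {T : Pred ([ Ω ]^ s) 0ℓ} → UniformΔSystem T →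
      ∀ {L l X Y Y′} → X ∈ T → Y ∈ T → Y′ ∈ T → L ℕ.≤ l → N ℕ.≤ l →
      LinkedBelow L X Y → Y ≡ Y′ ⊎ ΔCaptured S ⟦ Y , Y′ ⟧ l → Linked X Y′
    amalgamate U X∈ Y∈ Y′∈ L≤l N≤l (inj₁ refl) (inj₁ Y≡Y′) = inj₁ Y≡Y′
    amalgamate U X∈ Y∈ Y′∈ L≤l N≤l (inj₁ refl) (inj₂ cap)  = inj₂ (_ , N≤l , inj₁ cap)
    amalgamate U X∈ Y∈ Y′∈ L≤l N≤l (inj₂ (l′ , _ , at)) (inj₁ refl) = inj₂ (l′ , at)
    amalgamate {T} U {X = X} {Y} {Y′} X∈ Y∈ Y′∈ L≤l N≤l (inj₂ (l′ , l′<L , N≤l′ , cap′)) (inj₂ cap)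
      with em {P = X ≡ Y′}
    ... | yes X≡Y′ = inj₁ X≡Y′
    ... | no  X≢Y′ = inj₂ (l′ , N≤l′ , Sum.map
      (λ c → Twins-captured U ⟦ X , Y ⟧ ⟦ X , Y′ ⟧ (both X∈ Y∈) (both X∈ Y′∈) c X≢Y′
        (λ { zero _ → Twins-refl ; one a → twins a }))
      (λ c → Twins-captured U ⟦ Y , X ⟧ ⟦ Y′ , X ⟧ (both Y∈ X∈) (both Y′∈ X∈) c (X≢Y′ ∘ sym)
        (λ { zero a → twins a ; one _ → Twins-refl })) cap′)
      where
      both : ∀ {V W} → V ∈ T → W ∈ T → ∀ j → ⟦ V , W ⟧ j ∈ T
      both p q zero = p
      both p q one  = q

      twins : ∀ a → Twins l′ (Y ⟨ a ⟩) (Y′ ⟨ a ⟩)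
      twins = captured⇒Twins cap (ℕ.<-≤-trans l′<L L≤l)

-- Amalgamation of finite sets of pairwise linked sets

uniform-bound : {A : Set} (P : ℕ → A → Set) →
  (∀ {k l x} → k ℕ.≤ l → P k x → P l x) →
  ∀ xs → (∀ {x} → x ∈ˡ xs → ∃[ l ] P l x) → ∃[ l ] (∀ {x} → x ∈ˡ xs → P l x)
uniform-bound P mono []       h = 0 , λ ()
uniform-bound P mono (x ∷ xs) h with h (here refl) | uniform-bound P mono xs (h ∘ there)
... | k , pk | l , pl = k ℕ.⊔ l , λ
  { (here refl) → mono (ℕ.m≤m⊔n k l) pk ; (there x∈) → mono (ℕ.m≤n⊔m k l) (pl x∈) }

module Positions (em : ∀ {ℓ} → ExcludedMiddle ℓ) (Ω : Omega₁) where

  open Omega₁ Ω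
  open FiniteSubsets em Ω

  Elᶠ : FinSubset Ω → Pred Ordinal 0ℓ
  Elᶠ W = El (proj₂ W)

  abstract

    position : FinSubset Ω → Ordinal → ℕ
    position W α with em {P = α ∈ Elᶠ W}
    ... | yes (i , _) = toℕ i
    -- A default: codes are compared only for subsets of `W`.
    ... | no _        = 0

    position-correct : ∀ W {α} → α ∈ Elᶠ W →
                       Σ[ i ∈ Fin (proj₁ W) ] (proj₂ W ⟨ i ⟩ ≡ α × toℕ i ≡ position W α)
    position-correct W {α} α∈W with em {P = α ∈ Elᶠ W}
    ... | yes (i , Wi≡α) = i , Wi≡α , refl
    ... | no  α∉W        = contradiction α∈W α∉W

  pattern-code : ∀ {t} → FinSubset Ω → [ Ω ]^ t → ℕ
  pattern-code {t} W E = encodeFun t (λ i → position W (E ⟨ i ⟩))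

  pattern-code-determines : ∀ {t} W (E F : [ Ω ]^ t) → El E ⊆ Elᶠ W → El F ⊆ Elᶠ W →
    pattern-code W E ≡ pattern-code W F → E ≡ F
  pattern-code-determines W E F E⊆W F⊆W eq = []^-ext E F λ i →
    let a , Wa≡ , a≡ = position-correct W (E⊆W (i , refl))
        b , Wb≡ , b≡ = position-correct W (F⊆W (i , refl))
        a≡b = Fin.toℕ-injective (trans a≡ (trans (encodeFun-injective _ _ _ eq i) (sym b≡)))
    in trans (sym Wa≡) (trans (cong (λ c → proj₂ W ⟨ c ⟩) a≡b) Wb≡)

  support : ∀ {s} → List ([ Ω ]^ s) → List Ordinal
  support []      = []
  support (X ∷ A) = List.tabulate (X ⟨_⟩) ++ support A

  ∈-tabulate-⟨⟩ : ∀ {n} (X : [ Ω ]^ n) {α} → α ∈ El X → α ∈ˡ List.tabulate (X ⟨_⟩)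
  ∈-tabulate-⟨⟩ X (i , refl) = ∈-tabulate⁺ {f = X ⟨_⟩} i

  ∈-support : ∀ {s} {A : List ([ Ω ]^ s)} {X α} → X ∈ˡ A → α ∈ El X → α ∈ˡ support A
  ∈-support {A = X ∷ A} (here refl) α∈X = ∈-++⁺ˡ (∈-tabulate-⟨⟩ X α∈X)
  ∈-support {A = X ∷ A} (there X∈A) α∈X = ∈-++⁺ʳ (List.tabulate (X ⟨_⟩)) (∈-support X∈A α∈X)

  cover : ∀ {s} (A : List ([ Ω ]^ s)) (E : FinSubset Ω) →
    Σ[ V ∈ FinSubset Ω ] ((∀ {X} → X ∈ˡ A → El X ⊆ Elᶠ V) × Elᶠ E ⊆ Elᶠ V)
  cover A E = proj₁ union ,
    (λ X∈A α∈X → proj₂ union (∈-++⁺ʳ (List.tabulate (proj₂ E ⟨_⟩)) (∈-support X∈A α∈X))) ,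
    (λ α∈E → proj₂ union (∈-++⁺ˡ (∈-tabulate-⟨⟩ (proj₂ E) α∈E)))
    where
    union : Σ[ V ∈ FinSubset Ω ]
              (∀ {α} → α ∈ˡ List.tabulate (proj₂ E ⟨_⟩) ++ support A → Elᶠ V α)
    union = enumerate (List.tabulate (proj₂ E ⟨_⟩) ++ support A)

module Amalgamation (em : ∀ {ℓ} → ExcludedMiddle ℓ) {Ω : Omega₁} {τ : SchemeType}
                    (S : ConstructionScheme Ω τ) (capturing : TwoΔCapturing S)
                    (N : ℕ) {s : ℕ} {T : Pred ([ Ω ]^ s) 0ℓ} where

  open Omega₁ Ω
  open Classical em
  open FiniteSubsets em Ω
  open Positions em Ω
  open Captures em S

  -- Equal codes mean equal indices in the two covers, which gives the common `π` of
  -- `corresponding-captured`.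
  same-pattern-captured : ∀ {v t l} {D : Fin 2 → [ Ω ]^ v} → ΔCaptured S D l →
    (E : Fin 2 → [ Ω ]^ t) → (∀ j → El (E j) ⊆ El (D j)) →
    pattern-code (v , D zero) (E zero) ≡ pattern-code (v , D one) (E one) →
    E zero ≢ E one → ΔCaptured S E l
  same-pattern-captured {v} {t} {D = D} cap E E⊆D same E≢ =
    corresponding-captured cap E (index zero) entry E≢
    where
    correct : ∀ j i → Σ[ a ∈ Fin v ] (D j ⟨ a ⟩ ≡ E j ⟨ i ⟩ × toℕ a ≡ position (v , D j) (E j ⟨ i ⟩))
    correct j i = position-correct (v , D j) (E⊆D j (i , refl))

    index : Fin 2 → Fin t → Fin v
    index j i = proj₁ (correct j i)

    index-agree : ∀ i → index one i ≡ index zero i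
    index-agree i = Fin.toℕ-injective (trans (proj₂ (proj₂ (correct one i)))
      (trans (sym (encodeFun-injective _ _ _ same i)) (sym (proj₂ (proj₂ (correct zero i))))))

    entry : ∀ j i → E j ⟨ i ⟩ ≡ D j ⟨ index zero i ⟩
    entry zero i = sym (proj₁ (proj₂ (correct zero i)))
    entry one  i = trans (sym (proj₁ (proj₂ (correct one i)))) (cong (λ a → D one ⟨ a ⟩) (index-agree i))

  Coherent : Pred (List ([ Ω ]^ s)) 0ℓ
  Coherent A = (∀ {X} → X ∈ˡ A → X ∈ T) × (∀ {X Y} → X ∈ˡ A → Y ∈ˡ A → Linked N X Y)

  CrossLinked : List ([ Ω ]^ s) → List ([ Ω ]^ s) → Set
  CrossLinked A B = ∀ X Y → X ∈ˡ A → Y ∈ˡ B → Linked N X Y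

  Coherent-++ : ∀ {A B} → Coherent A → Coherent B → CrossLinked A B → Coherent (A ++ B)
  Coherent-++ {A} {B} (A⊆T , A-linked) (B⊆T , B-linked) cross = ⊆T , linked
    where
    ⊆T : ∀ {X} → X ∈ˡ A ++ B → X ∈ T
    ⊆T X∈ with ∈-++⁻ A X∈
    ... | inj₁ X∈A = A⊆T X∈A
    ... | inj₂ X∈B = B⊆T X∈B

    linked : ∀ {X Y} → X ∈ˡ A ++ B → Y ∈ˡ A ++ B → Linked N X Y
    linked X∈ Y∈ with ∈-++⁻ A X∈ | ∈-++⁻ A Y∈
    ... | inj₁ X∈A | inj₁ Y∈A = A-linked X∈A Y∈A
    ... | inj₁ X∈A | inj₂ Y∈B = cross _ _ X∈A Y∈B
    ... | inj₂ X∈B | inj₁ Y∈A = Linked-sym N (cross _ _ Y∈A X∈B)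
    ... | inj₂ X∈B | inj₂ Y∈B = B-linked X∈B Y∈B

  Coherent⇒bounded : ∀ {A} → Coherent A →
    ∃[ L ] (∀ {X} → X ∈ˡ A → ∀ {Y} → Y ∈ˡ A → LinkedBelow N L X Y)
  Coherent⇒bounded {A} (_ , linked) =
    uniform-bound (λ L X → ∀ {Y} → Y ∈ˡ A → LinkedBelow N L X Y)
      (λ k≤l p Y∈ → raise k≤l (p Y∈)) A
      λ {X} X∈ → uniform-bound (λ L Y → LinkedBelow N L X Y) raise A λ Y∈ → level (linked X∈ Y∈)
    where
    raise : ∀ {k l X Y} → k ℕ.≤ l → LinkedBelow N k X Y → LinkedBelow N l X Y
    raise k≤l = Sum.map₂ λ (i , i<k , at) → i , ℕ.<-≤-trans i<k k≤l , at

    level : ∀ {X Y} → Linked N X Y → ∃[ L ] LinkedBelow N L X Y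
    level (inj₁ X≡Y)      = 0 , inj₁ X≡Y
    level (inj₂ (l , at)) = suc l , inj₂ (l , ℕ.n<1+n l , at)

  -- The equations are there because sizes are bundled with the sets. The implication admits equal
  -- sets, as when `e` is constant.
  CapturedFrom : ℕ → FinSubset Ω → FinSubset Ω → Set
  CapturedFrom M F F′ = ∃[ l ] (M ℕ.≤ l × (∃[ t ] Σ[ E ∈ (Fin 2 → [ Ω ]^ t) ]
    ((t , E zero) ≡ F × (t , E one) ≡ F′ × (E zero ≢ E one → ΔCaptured S E l))))

  module _ {B : Set} (a : B → List ([ Ω ]^ s)) (e : B → FinSubset Ω)
           (coherent : ∀ x → Coherent (a x)) (U : UniformΔSystem T) where

    private
      V : B → FinSubset Ω
      V x = proj₁ (cover (a x) (e x))

      a⊆V : ∀ x {X} → X ∈ˡ a x → El X ⊆ Elᶠ (V x)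
      a⊆V x = proj₁ (proj₂ (cover (a x) (e x)))

      e⊆V : ∀ x → Elᶠ (e x) ⊆ Elᶠ (V x)
      e⊆V x = proj₂ (proj₂ (cover (a x) (e x)))

      L : B → ℕ
      L x = proj₁ (Coherent⇒bounded (coherent x))

      patterns : B → List ℕ
      patterns x = List.map (pattern-code (V x)) (a x)

      code : B → ℕ
      code x = pair (L x) (pair (proj₁ (e x))
                 (pair (pattern-code (V x) (proj₂ (e x))) (encodeList (patterns x))))

      record SameShape (x y : B) : Set where
        field
          levels    : L x ≡ L y
          sizes     : proj₁ (e x) ≡ proj₁ (e y)
          e-pattern : pattern-code (V x) (proj₂ (e x)) ≡ pattern-code (V y) (proj₂ (e y))
          a-pattern : patterns x ≡ patterns y

      same-code : ∀ x y → code x ≡ code y → SameShape x y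
      same-code x y eq = record
        { levels    = proj₁ p₁
        ; sizes     = proj₁ p₂
        ; e-pattern = proj₁ p₃
        ; a-pattern = encodeList-injective _ _ (proj₂ p₃)
        }
        where
        p₁ = pair-injective _ _ _ _ eq
        p₂ = pair-injective _ _ _ _ (proj₂ p₁)
        p₃ = pair-injective _ _ _ _ (proj₂ p₂)

      partner : ∀ {x y} → SameShape x y → ∀ {Y} → Y ∈ˡ a y →
        Σ[ X ∈ [ Ω ]^ s ] (X ∈ˡ a x × pattern-code (V x) X ≡ pattern-code (V y) Y)
      partner {x} {y} same {Y} Y∈ =
        let X , X∈ , eq = ∈-map⁻ (pattern-code (V x)) (subst (pattern-code (V y) Y ∈ˡ_)
                            (sym (SameShape.a-pattern same)) (∈-map⁺ (pattern-code (V y)) Y∈))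
        in X , X∈ , sym eq

      same-cover⇒e≡ : ∀ W (F F′ : FinSubset Ω) → proj₁ F ≡ proj₁ F′ →
        Elᶠ F ⊆ Elᶠ W → Elᶠ F′ ⊆ Elᶠ W →
        pattern-code W (proj₂ F) ≡ pattern-code W (proj₂ F′) → F ≡ F′
      same-cover⇒e≡ W (t , F) (t , F′) refl F⊆ F′⊆ eq =
        cong (t ,_) (pattern-code-determines W F F′ F⊆ F′⊆ eq)

      -- Inside one cover a pattern determines its set. This makes `V` injective on a class of equal
      -- shapes, so that uncountably many covers are available for capturing.
      same-cover : ∀ {x y} → SameShape x y → V x ≡ V y →
        (∀ {Y} → Y ∈ˡ a y → Y ∈ˡ a x) × e x ≡ e y
      same-cover {x} {y} same Vx≡Vy =
        (λ {Y} Y∈ → let X , X∈ , eq = partner same Y∈ in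
          subst (_∈ˡ a x) (pattern-code-determines (V x) X Y (a⊆V x X∈)
            (λ {α} α∈ → subst (λ W → Elᶠ W α) (sym Vx≡Vy) (a⊆V y Y∈ α∈))
            (trans eq (cong (λ W → pattern-code W Y) (sym Vx≡Vy)))) X∈) ,
        same-cover⇒e≡ (V x) (e x) (e y) (SameShape.sizes same) (e⊆V x)
          (λ {α} α∈ → subst (λ W → Elᶠ W α) (sym Vx≡Vy) (e⊆V y α∈))
          (trans (SameShape.e-pattern same) (cong (λ W → pattern-code W (proj₂ (e y))) (sym Vx≡Vy)))

      module _ {x y : B} (same : SameShape x y) {v l : ℕ} {D : Fin 2 → [ Ω ]^ v}
               (V₀ : V x ≡ (v , D zero)) (V₁ : V y ≡ (v , D one)) (cap : ΔCaptured S D l) where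

        cross-linked : L x ℕ.≤ l → N ℕ.≤ l → CrossLinked (a x) (a y)
        cross-linked L≤l N≤l X Y′ X∈ Y′∈ = amalgamate N U
          (proj₁ (coherent x) X∈) (proj₁ (coherent x) Y∈) (proj₁ (coherent y) Y′∈) L≤l N≤l
          (proj₂ (Coherent⇒bounded (coherent x)) X∈ Y∈) twin
          where
          Y : [ Ω ]^ s
          Y = proj₁ (partner same Y′∈)

          Y∈ : Y ∈ˡ a x
          Y∈ = proj₁ (proj₂ (partner same Y′∈))

          Y⊆D : ∀ j → El (⟦ Y , Y′ ⟧ j) ⊆ El (D j)
          Y⊆D zero {α} α∈ = subst (λ W → Elᶠ W α) V₀ (a⊆V x Y∈ α∈)
          Y⊆D one  {α} α∈ = subst (λ W → Elᶠ W α) V₁ (a⊆V y Y′∈ α∈)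

          twin : Y ≡ Y′ ⊎ ΔCaptured S ⟦ Y , Y′ ⟧ l
          twin with em {P = Y ≡ Y′}
          ... | yes Y≡Y′ = inj₁ Y≡Y′
          ... | no  Y≢Y′ = inj₂ (same-pattern-captured cap ⟦ Y , Y′ ⟧ Y⊆D
            (subst₂ (λ W W′ → pattern-code W Y ≡ pattern-code W′ Y′) V₀ V₁
              (proj₂ (proj₂ (partner same Y′∈)))) Y≢Y′)

        e-captured : ∀ {M} → M ℕ.≤ l → CapturedFrom M (e x) (e y)
        e-captured M≤l = l , M≤l , pairing (e x) (e y) (SameShape.sizes same)
          (λ {α} α∈ → subst (λ W → Elᶠ W α) V₀ (e⊆V x α∈))
          (λ {α} α∈ → subst (λ W → Elᶠ W α) V₁ (e⊆V y α∈))
          (subst₂ (λ W W′ → pattern-code W (proj₂ (e x)) ≡ pattern-code W′ (proj₂ (e y))) V₀ V₁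
            (SameShape.e-pattern same))
          where
          pairing : ∀ F F′ → proj₁ F ≡ proj₁ F′ → Elᶠ F ⊆ El (D zero) → Elᶠ F′ ⊆ El (D one) →
            pattern-code (v , D zero) (proj₂ F) ≡ pattern-code (v , D one) (proj₂ F′) →
            ∃[ t ] Σ[ E ∈ (Fin 2 → [ Ω ]^ t) ]
              ((t , E zero) ≡ F × (t , E one) ≡ F′ × (E zero ≢ E one → ΔCaptured S E l))
          pairing (t , F) (t , F′) refl F⊆ F′⊆ eq = t , ⟦ F , F′ ⟧ , refl , refl ,
            same-pattern-captured cap ⟦ F , F′ ⟧
              (λ { zero α∈ → F⊆ α∈ ; one α∈ → F′⊆ α∈ }) eq

    -- Shapes are coded by natural numbers, so uncountably many `x` share one, and two of their
    -- covers get captured. Injectivity is asked for in terms of inclusion of lists, which an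
    -- antichain satisfies because inclusion implies compatibility.
    cross-linked-pair : {Q : Pred B 0ℓ} → Uncountable Q →
      (∀ x y → x ∈ Q → y ∈ Q → (∀ {Y} → Y ∈ˡ a y → Y ∈ˡ a x) → e x ≡ e y → x ≡ y) →
      ∀ M → ∃[ x ] ∃[ y ] (x ∈ Q × y ∈ Q × x ≢ y ×
        CrossLinked (a x) (a y) × CapturedFrom M (e x) (e y))
    cross-linked-pair {Q} unc inj M = found (pigeonhole unc code)
      where
      found : ∃[ n ] Uncountable (λ x → x ∈ Q × code x ≡ n) →
        ∃[ x ] ∃[ y ] (x ∈ Q × y ∈ Q × x ≢ y × CrossLinked (a x) (a y) × CapturedFrom M (e x) (e y))
      found (n , unc-n) = extract (Uncountable⇒inhabited unc-n)
        where
        Q′ : Pred B 0ℓ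
        Q′ x = x ∈ Q × code x ≡ n

        shape : ∀ {x y} → x ∈ Q′ → y ∈ Q′ → SameShape x y
        shape {x} {y} (_ , cx) (_ , cy) = same-code x y (trans cx (sym cy))

        V-inj : ∀ x y → x ∈ Q′ → y ∈ Q′ → V x ≡ V y → x ≡ y
        V-inj x y x∈ y∈ eq = let a⊆ , e≡ = same-cover (shape x∈ y∈) eq in
          inj x y (proj₁ x∈) (proj₁ y∈) a⊆ e≡

        extract : ∃[ z ] z ∈ Q′ → ∃[ x ] ∃[ y ] (x ∈ Q × y ∈ Q × x ≢ y ×
                    CrossLinked (a x) (a y) × CapturedFrom M (e x) (e y))
        extract (z , z∈)
          -- The level must reach the bounds of `x` and `y`, which the capture has yet to produce;
          -- all of `Q′` shares the bound of `z`.
          with capturing (Image V Q′) (Uncountable-Image V V-inj unc-n) (L z + N + M)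
        ... | l , ≤l , v , D , D∈ , cap with D∈ zero | D∈ one
        ...   | x , x∈ , V₀ | y , y∈ , V₁ =
          x , y , proj₁ x∈ , proj₁ y∈ , x≢y ,
          cross-linked (shape x∈ y∈) V₀ V₁ cap
            (subst (ℕ._≤ l) (sym (SameShape.levels (shape x∈ z∈)))
              (ℕ.≤-trans (ℕ.m≤m+n (L z) N) (ℕ.≤-trans (ℕ.m≤m+n (L z + N) M) ≤l)))
            (ℕ.≤-trans (ℕ.m≤n+m N (L z)) (ℕ.≤-trans (ℕ.m≤m+n (L z + N) M) ≤l)) ,
          e-captured (shape x∈ y∈) V₀ V₁ cap (ℕ.≤-trans (ℕ.m≤n+m M (L z + N)) ≤l)
          where
          x≢y : x ≢ y
          x≢y refl = proj₁ (ΔCaptured.Δ-system cap zero one 0≢1)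
            (same-enum (trans (sym V₀) V₁))
            where
            same-enum : ∀ {X Y : [ Ω ]^ v} → (v , X) ≡ (v , Y) → X ≡ Y
            same-enum refl = refl

-- The Δ-system lemma

module ΔSystemLemma (em : ∀ {ℓ} → ExcludedMiddle ℓ) {Ω : Omega₁} {τ : SchemeType}
                    (S : ConstructionScheme Ω τ) where

  open Omega₁ Ω
  open Classical em
  open Ordinals em Ω
  open FiniteSubsets em Ω
  open Captures em S
  private module O = IsStrictTotalOrder isStrictTotalOrder

  module _ {s : ℕ} where

    Agree : ℕ → [ Ω ]^ s → [ Ω ]^ s → Set
    Agree k X Y = ∀ a → toℕ a ℕ.< k → X ⟨ a ⟩ ≡ Y ⟨ a ⟩

    CommonRoot : Pred ([ Ω ]^ s) 0ℓ → ℕ → Set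
    CommonRoot T k = Σ[ X₀ ∈ [ Ω ]^ s ] Uncountable (λ X → X ∈ T × Agree k X X₀)

    last-index : ∀ {n} → Fin n → Σ[ b ∈ Fin n ] (∀ (a : Fin n) → toℕ a ℕ.≤ toℕ b)
    last-index {suc n} _ = Fin.fromℕ n , Fin.≤fromℕ

    change-point : (P : Pred ℕ 0ℓ) → P 0 → ∀ n → ¬ P n →
                   ∃[ k ] (k ℕ.< n × P k × ¬ P (suc k))
    change-point P p0 zero    ¬pn = contradiction p0 ¬pn
    change-point P p0 (suc n) ¬pn with em {P = P n}
    ... | yes pn = n , ℕ.n<1+n n , pn , ¬pn
    ... | no ¬pn′ = let k , k<n , rest = change-point P p0 n ¬pn′ in k , ℕ.m<n⇒m<1+n k<n , rest

    module _ {T : Pred ([ Ω ]^ s) 0ℓ} {k : ℕ} (k<s : k ℕ.< s) (X₀ : [ Ω ]^ s)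
             (maximal : ¬ CommonRoot T (suc k)) where

      private
        ι : Fin s
        ι = Fin.fromℕ< k<s

        last : Σ[ b ∈ Fin s ] (∀ (a : Fin s) → toℕ a ℕ.≤ toℕ b)
        last = last-index ι

        T₀ : Pred ([ Ω ]^ s) 0ℓ
        T₀ X = X ∈ T × Agree k X X₀

      lo hi : [ Ω ]^ s → Ordinal
      lo X = X ⟨ ι ⟩
      hi X = X ⟨ proj₁ last ⟩

      lo≤hi : ∀ X → ¬ hi X < lo X
      lo≤hi X = ⟨⟩-mono-≮ X (proj₂ last ι)

      -- The members of an uncountable fibre would agree on entry k as well, hence on k + 1 entries,
      -- against `maximal`.
      lo-fibres-countable : ∀ ξ → Countable (λ X → X ∈ T₀ × lo X ≡ ξ)
      lo-fibres-countable ξ = by-contradiction λ unc → larger-root unc (Uncountable⇒inhabited unc)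
        where
        Fibre : Pred ([ Ω ]^ s) 0ℓ
        Fibre X = X ∈ T₀ × lo X ≡ ξ

        larger-root : Uncountable Fibre → ¬ (∃[ X ] X ∈ Fibre)
        larger-root unc (X₁ , (_ , X₁~X₀) , loX₁≡ξ) =
          maximal (X₁ , λ ct → unc (Countable-⊆ (λ X∈ → proj₁ (proj₁ X∈) , agree X∈) ct))
          where
          agree : ∀ {X} → X ∈ Fibre → Agree (suc k) X X₁
          agree ((_ , X~X₀) , loX≡ξ) a a<1+k with ℕ.m≤n⇒m<n∨m≡n (ℕ.≤-pred a<1+k)
          ... | inj₁ a<k = trans (X~X₀ a a<k) (sym (X₁~X₀ a a<k))
          ... | inj₂ a≡k with Fin.toℕ-injective (trans a≡k (sym (Fin.toℕ-fromℕ< k<s)))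
          ...   | refl = trans loX≡ξ (sym loX₁≡ξ)

      module _ {T′ : Pred ([ Ω ]^ s) 0ℓ} (T′⊆T₀ : T′ ⊆ T₀)
               (sep : ∀ X Y → X ∈ T′ → Y ∈ T′ → X ≢ Y → hi X < lo Y ⊎ hi Y < lo X) where

        private
          k≤s : k ℕ.≤ s
          k≤s = ℕ.<⇒≤ k<s

          R : [ Ω ]^ k
          R = proj₁ (prefix k≤s X₀)

          entry : ∀ {X} → X ∈ T′ → ∀ b a → toℕ b ≡ toℕ a → X ⟨ a ⟩ ≡ R ⟨ b ⟩
          entry X∈ b a b≡a = trans (proj₂ (T′⊆T₀ X∈) a (subst (ℕ._< k) b≡a (Fin.toℕ<n b)))
            (sym (proj₂ (prefix k≤s X₀) b a b≡a))

          R⊆ : ∀ {X} → X ∈ T′ → El R ⊆ El X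
          R⊆ X∈ (b , refl) = Fin.inject≤ b k≤s , entry X∈ b _ (sym (Fin.toℕ-inject≤ b k≤s))

          tail-index : ∀ {X} → X ∈ T′ → ∀ a → X ⟨ a ⟩ ∉ El R → k ℕ.≤ toℕ a
          tail-index X∈ a ∉R = ℕ.≮⇒≥ λ a<k →
            ∉R (Fin.fromℕ< a<k , sym (entry X∈ _ a (Fin.toℕ-fromℕ< a<k)))

          below : ∀ X → X ∈ T′ → El R ≺ (El X ∖ El R)
          below X X∈ (b , refl) ((a , refl) , ∉R) =
            subst (_< X ⟨ a ⟩) (entry X∈ b b′ (sym (Fin.toℕ-inject≤ b k≤s)))
              (⟨⟩-increasing X (ℕ.<-≤-trans
                (subst (ℕ._< k) (sym (Fin.toℕ-inject≤ b k≤s)) (Fin.toℕ<n b)) (tail-index X∈ a ∉R)))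
            where
            b′ : Fin s
            b′ = Fin.inject≤ b k≤s

          tails-≺ : ∀ {X Y} → X ∈ T′ → Y ∈ T′ → hi X < lo Y → (El X ∖ El R) ≺ (El Y ∖ El R)
          tails-≺ {X} {Y} X∈ Y∈ hi<lo ((a , refl) , _) ((b , refl) , ∉R) =
            <-≮-trans (≮-<-trans (⟨⟩-mono-≮ X (proj₂ last a)) hi<lo)
              (⟨⟩-mono-≮ Y (subst (ℕ._≤ toℕ b) (sym (Fin.toℕ-fromℕ< k<s)) (tail-index Y∈ b ∉R)))

          compare-tails : ∀ X Y → X ∈ T′ → Y ∈ T′ → X ≢ Y →
            ((El X ∖ El R) ≺ (El Y ∖ El R)) ⊎ ((El Y ∖ El R) ≺ (El X ∖ El R))
          compare-tails X Y X∈ Y∈ X≢Y with sep X Y X∈ Y∈ X≢Y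
          ... | inj₁ lt = inj₁ (tails-≺ X∈ Y∈ lt)
          ... | inj₂ lt = inj₂ (tails-≺ Y∈ X∈ lt)

          ∩⊆R : ∀ X Y → X ∈ T′ → Y ∈ T′ → X ≢ Y → ∀ {α} → α ∈ El X → α ∈ El Y → α ∈ El R
          ∩⊆R X Y X∈ Y∈ X≢Y α∈X α∈Y = by-contradiction λ α∉R →
            Sum.[ (λ X≺Y → O.irrefl refl (X≺Y (α∈X , α∉R) (α∈Y , α∉R)))
                , (λ Y≺X → O.irrefl refl (Y≺X (α∈Y , α∉R) (α∈X , α∉R))) ]
              (compare-tails X Y X∈ Y∈ X≢Y)

        separated⇒uniform : UniformΔSystem T′
        separated⇒uniform = record
          { r          = k
          ; R          = R
          ; Δ-system   = λ D D∈ D≢ → ΔSystem-pair D R D≢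
                           (∩⊆R (D zero) (D one) (D∈ zero) (D∈ one) D≢) (λ j → R⊆ (D∈ j))
          ; root-below = below
          ; comparable = compare-tails
          }

        lo-injective : ∀ X Y → X ∈ T′ → Y ∈ T′ → lo X ≡ lo Y → X ≡ Y
        lo-injective X Y X∈ Y∈ eq = by-contradiction λ X≢Y → clash (sep X Y X∈ Y∈ X≢Y)
          where
          clash : ¬ (hi X < lo Y ⊎ hi Y < lo X)
          clash (inj₁ lt) = lo≤hi X (subst (hi X <_) (sym eq) lt)
          clash (inj₂ lt) = lo≤hi Y (subst (hi Y <_) eq lt)

    -- `lo` will measure how far a coherent list reaches; its injectivity makes `separate`
    -- applicable once more.
    UniformSubfamily : Pred ([ Ω ]^ s) 0ℓ → Set₁
    UniformSubfamily T =
      Σ[ T′ ∈ Pred ([ Ω ]^ s) 0ℓ ] (T′ ⊆ T × Uncountable T′ × UniformΔSystem T′ ×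
        Σ[ lo ∈ ([ Ω ]^ s → Ordinal) ] (∀ X Y → X ∈ T′ → Y ∈ T′ → lo X ≡ lo Y → X ≡ Y))

    -- Take k where uncountable agreement on initial entries stops. The agreed entries form the
    -- root, and entry k takes each value only countably often, so `separate` applies to entry k and
    -- the last entry.
    Δ-system-lemma : {T : Pred ([ Ω ]^ s) 0ℓ} → Uncountable T → UniformSubfamily T
    Δ-system-lemma {T} unc = build (change-point (CommonRoot T) no-root s full-root)
      where
      no-root : CommonRoot T 0
      no-root = let X₀ , _ = Uncountable⇒inhabited unc in
        X₀ , λ ct → unc (Countable-⊆ (λ X∈ → X∈ , λ _ ()) ct)

      full-root : ¬ CommonRoot T s
      full-root (X₀ , unc′) = unc′ (Countable-subsingleton λ X Y (_ , X~) (_ , Y~) →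
        []^-ext X Y λ a → trans (X~ a (Fin.toℕ<n a)) (sym (Y~ a (Fin.toℕ<n a))))

      build : ∃[ k ] (k ℕ.< s × CommonRoot T k × ¬ CommonRoot T (suc k)) → UniformSubfamily T
      build (k , k<s , (X₀ , unc₀) , maximal) =
        let T′ , T′⊆T₀ , unc′ , sep = separate (lo k<s X₀ maximal) (hi k<s X₀ maximal) unc₀
              (lo-fibres-countable k<s X₀ maximal) (λ X _ → lo≤hi k<s X₀ maximal X)
        in T′ , (λ X∈ → proj₁ (T′⊆T₀ X∈)) , unc′ ,
           separated⇒uniform k<s X₀ maximal T′⊆T₀ sep ,
           lo k<s X₀ maximal , lo-injective k<s X₀ maximal T′⊆T₀ sep

-- Forcing

module Preservation (em : ∀ {ℓ} → ExcludedMiddle ℓ) (P : Forcing) where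

  open Forcing P
  open ForcingRelation P
  open Classical em
  private
    module ≤ = IsPreorder isPreorder

    ≤-refl : ∀ {p} → p ≤ p
    ≤-refl = ≤.reflexive refl

  ∈ᶠ-mono : {A : Set} {x : A} (Ṡ : Name A) → ∀ {p q} → q ≤ p → (x ∈ᶠ Ṡ) p → (x ∈ᶠ Ṡ) q
  ∈ᶠ-mono Ṡ q≤p x∈ r r≤q = x∈ r (≤.trans r≤q q≤p)

  Possible : {A : Set} → Condition → Name A → Pred A 0ℓ
  Possible q Ṡ x = ∃[ p ] (p ≤ q × (x ∈ᶠ Ṡ) p)

  -- A ground-model injection on the possible elements stays injective on those that occur in the
  -- extension.
  Possible-countable⇒Countableᶠ : {A : Set} (Ṡ : Name A) → ∀ q →
    Countable (Possible q Ṡ) → Countableᶠ Ṡ q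
  Possible-countable⇒Countableᶠ {A} Ṡ q (f , f-inj) p p≤q =
    p , ≤-refl , ḟ , total , functional , injective
    where
    ḟ : Name (A × ℕ)
    -- The check name of the graph: each of its pairs is attached to every condition.
    ḟ (x , n) _ = f x ≡ n

    value : ∀ {x n r} → ((x , n) ∈ᶠ ḟ) r → f x ≡ n
    value fx = let _ , _ , _ , e , _ = fx _ ≤-refl in e

    total : (∀ᶠ A λ x → x ∈ᶠ Ṡ ⇒ᶠ ∃ᶠ ℕ λ n → (x , n) ∈ᶠ ḟ) p
    total x r r≤p x∈ t t≤r = t , ≤-refl , f x , λ u u≤t → u , ≤-refl , u , refl , ≤-refl

    functional : (∀ᶠ A λ x → ∀ᶠ ℕ λ n → ∀ᶠ ℕ λ n′ →
      ((x , n) ∈ᶠ ḟ ∧ᶠ (x , n′) ∈ᶠ ḟ) ⇒ᶠ ⌜ n ≡ n′ ⌝) p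
    functional x n n′ r r≤p (fx , fx′) = trans (sym (value fx)) (value fx′)

    injective : (∀ᶠ A λ x → ∀ᶠ A λ y → ∀ᶠ ℕ λ n →
      (x ∈ᶠ Ṡ ∧ᶠ y ∈ᶠ Ṡ ∧ᶠ (x , n) ∈ᶠ ḟ ∧ᶠ (y , n) ∈ᶠ ḟ) ⇒ᶠ ⌜ x ≡ y ⌝) p
    injective x y n r r≤p (x∈ , y∈ , fx , fy) =
      f-inj x y (r , ≤.trans r≤p p≤q , x∈) (r , ≤.trans r≤p p≤q , y∈)
        (trans (value fx) (sym (value fy)))

  module _ {Ω : Omega₁} {τ : SchemeType} (S : ConstructionScheme Ω τ) where

    CompatibleCapture : Pred (FinSubset Ω) 0ℓ → (FinSubset Ω → Condition) → ℕ → Set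
    CompatibleCapture 𝓢 c N = ∃[ l ] (N ℕ.≤ l × (∃[ s ] Σ[ D ∈ (Fin 2 → [ Ω ]^ s) ]
      ((∀ j → (s , D j) ∈ 𝓢) × ΔCaptured S D l ×
       Compatible P (c (s , D zero)) (c (s , D (suc zero))))))

    -- A name forced to be uncountable has uncountably many possible elements. If c E forces E into
    -- the name, a common extension for a captured pair forces both of its sets in. The criterion
    -- serves `P` and ℙ alike.
    compatible-captures⇒preserves :
      (∀ 𝓢 → Uncountable 𝓢 → ∀ c N → CompatibleCapture 𝓢 c N) → TwoΔPreserves P S
    compatible-captures⇒preserves captures p 𝓢̇ q q≤p unc N q₁ q₁≤q =
      force (totalize {B = Condition} {Q = λ E r → r ≤ q₁ × (E ∈ᶠ 𝓢̇) r} q₁ (λ E E∈ → E∈))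
      where
      𝓢 : Pred (FinSubset Ω) 0ℓ
      𝓢 = Possible q₁ 𝓢̇

      𝓢-unc : Uncountable 𝓢
      𝓢-unc ct = unc q₁ q₁≤q (Possible-countable⇒Countableᶠ 𝓢̇ q₁ ct)

      Goal : ℕ → Sentence 0ℓ
      Goal l = ∃ᶠ ℕ λ s → ∃ᶠ (Fin 2 → [ Ω ]^ s) λ D →
                 (∀ᶠ (Fin 2) λ j → (s , D j) ∈ᶠ 𝓢̇) ∧ᶠ ⌜ ΔCaptured S D l ⌝

      force : Σ[ c ∈ (FinSubset Ω → Condition) ] (∀ E → E ∈ 𝓢 → c E ≤ q₁ × (E ∈ᶠ 𝓢̇) (c E)) →
              ∃[ r ] (r ≤ q₁ × (∃[ l ] (N ℕ.≤ l × Goal l r)))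
      force (c , c-spec) =
        let l , N≤l , s , D , D∈ , cap , r , r≤₀ , r≤₁ = captures 𝓢 𝓢-unc c N
            forced : ∀ j → ((s , D j) ∈ᶠ 𝓢̇) r
            forced = λ { zero → ∈ᶠ-mono 𝓢̇ r≤₀ (proj₂ (c-spec _ (D∈ zero)))
                       ; (suc zero) → ∈ᶠ-mono 𝓢̇ r≤₁ (proj₂ (c-spec _ (D∈ (suc zero)))) }
        in r , ≤.trans r≤₀ (proj₁ (c-spec _ (D∈ zero))) , l , N≤l ,
           λ u u≤r → u , ≤-refl , s , λ v v≤u → v , ≤-refl , D ,
             (λ j → ∈ᶠ-mono 𝓢̇ (≤.trans v≤u u≤r) (forced j)) , cap

-- The forcing with finite linked sets and its generic uncountable family.

module LinkedSubfamilies (em : ∀ {ℓ} → ExcludedMiddle ℓ) {Ω : Omega₁} {τ : SchemeType}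
                         (S : ConstructionScheme Ω τ) (capturing : TwoΔCapturing S)
                         (N : ℕ) {s : ℕ} {T : Pred ([ Ω ]^ s) 0ℓ} where

  open Omega₁ Ω
  open Classical em
  open Ordinals em Ω
  open FiniteSubsets em Ω
  open Captures em S
  open Amalgamation em S capturing N {s} {T}

  _⊆ˡ_ : List ([ Ω ]^ s) → List ([ Ω ]^ s) → Set
  A ⊆ˡ B = ∀ X → X ∈ˡ A → X ∈ˡ B

  -- Containing `A₀` amounts to working below one condition, chosen later so that the required sets
  -- are dense.
  linking : ∀ {A₀} → Coherent A₀ → Forcing
  linking {A₀} A₀-coherent = record
    { Condition  = Σ[ A ∈ List ([ Ω ]^ s) ] (A₀ ⊆ˡ A × Coherent A)
    ; _≤_        = λ p q → proj₁ q ⊆ˡ proj₁ p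
    ; isPreorder = record
      { isEquivalence = isEquivalence
      ; reflexive     = λ { refl X X∈ → X∈ }
      ; trans         = λ q⊆p r⊆q X X∈ → q⊆p X (r⊆q X X∈)
      }
    ; inhabitant = A₀ , (λ X X∈ → X∈) , A₀-coherent
    }

  module _ (U : UniformΔSystem T) where

    module _ {A₀ : List ([ Ω ]^ s)} (A₀-coherent : Coherent A₀) where

      private
        ℙ : Forcing
        ℙ = linking A₀-coherent

        open Forcing ℙ using (Condition)

        coherent : (p : Condition) → Coherent (proj₁ p)
        coherent p = proj₂ (proj₂ p)

      cross-linked⇒compatible : ∀ p q → CrossLinked (proj₁ p) (proj₁ q) → Compatible ℙ p q
      cross-linked⇒compatible p q cross =
        (proj₁ p ++ proj₁ q , (λ X X∈ → ∈-++⁺ˡ (proj₁ (proj₂ p) X X∈)) ,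
          Coherent-++ (coherent p) (coherent q) cross) ,
        (λ X X∈ → ∈-++⁺ˡ X∈) , (λ X X∈ → ∈-++⁺ʳ (proj₁ p) X∈)

      linking-ccc : CCC ℙ
      linking-ccc A antichain = by-contradiction λ unc →
        let p , q , p∈ , q∈ , p≢q , cross , _ =
              cross-linked-pair proj₁ (λ _ → proj₁ (enumerate [])) coherent U {Q = A} unc inj 0
        in antichain p q p∈ q∈ p≢q (cross-linked⇒compatible p q cross)
        where
        inj : ∀ p q → p ∈ A → q ∈ A → (∀ {Y} → Y ∈ˡ proj₁ q → Y ∈ˡ proj₁ p) → _ → p ≡ q
        inj p q p∈ q∈ q⊆p _ = by-contradiction λ p≢q →
          antichain p q p∈ q∈ p≢q (p , (λ X X∈ → X∈) , λ X X∈ → q⊆p X∈)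

      -- Each `E` is covered together with its own condition, so the covers that are captured
      -- contain both.
      linking-preserves : TwoΔPreserves ℙ S
      linking-preserves = compatible-captures⇒preserves S λ 𝓢 unc c M →
        found c (cross-linked-pair (proj₁ ∘ c) id (λ E → coherent (c E)) U {Q = 𝓢} unc (λ _ _ _ _ _ eq → eq) M)
        where
        open Preservation em ℙ

        found : ∀ {𝓢 M} c → ∃[ E ] ∃[ F ] (E ∈ 𝓢 × F ∈ 𝓢 × E ≢ F ×
                  CrossLinked (proj₁ (c E)) (proj₁ (c F)) × CapturedFrom M E F) →
                CompatibleCapture S 𝓢 c M
        found c (_ , _ , E∈ , F∈ , E≢F , cross , l , M≤l , t , D , refl , refl , cap) =
          l , M≤l , t , D , (λ { zero → E∈ ; (suc zero) → F∈ }) ,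
          cap (λ eq → E≢F (cong (t ,_) eq)) , cross-linked⇒compatible (c (t , D zero)) (c (t , D (suc zero))) cross

    module _ (lo : [ Ω ]^ s → Ordinal)
             (lo-injective : ∀ X Y → X ∈ T → Y ∈ T → lo X ≡ lo Y → X ≡ Y) where

      Reaches : Ordinal → List ([ Ω ]^ s) → Set
      Reaches α A = ∃[ X ] (X ∈ˡ A × α < lo X)

      -- This is the density below `A₀` of the sets `D α` to which the hypothesis on 𝔪^Δ is applied.
      Unbounded : List ([ Ω ]^ s) → Set
      Unbounded A₀ = ∀ A → A₀ ⊆ˡ A → Coherent A → ∀ α →
        ∃[ A′ ] (A ⊆ˡ A′ × Coherent A′ × Reaches α A′)

      private
        Bounded : List ([ Ω ]^ s) → Ordinal → Set
        Bounded A α = ∀ A′ → A ⊆ˡ A′ → Coherent A′ → ¬ Reaches α A′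

        CoherentBound : Set
        CoherentBound = Σ (List ([ Ω ]^ s)) Coherent × Ordinal

        BoundOf : [ Ω ]^ s → CoherentBound → Set
        BoundOf X ((A , _) , α) = X ∈ˡ A × Bounded A α

        -- After separation, two cross-linked lists A X and A Y have a coherent union. If hi X < lo
        -- Y, it contains `Y` and so extends A X past its bound; the other case is symmetric.
        bounds⇒⊥ : Uncountable T → (b : [ Ω ]^ s → CoherentBound) →
                   (∀ X → X ∈ T → BoundOf X (b X)) → ⊥
        bounds⇒⊥ unc b bound = clash (separate lo hi unc fibres lo≤hi)
          where
          A : [ Ω ]^ s → List ([ Ω ]^ s)
          A X = proj₁ (proj₁ (b X))

          A-coherent : ∀ X → Coherent (A X)
          A-coherent X = proj₂ (proj₁ (b X))

          hi : [ Ω ]^ s → Ordinal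
          hi X = proj₂ (b X)

          fibres : ∀ α → Countable (λ X → X ∈ T × lo X ≡ α)
          fibres α = Countable-subsingleton λ X Y (X∈ , eq) (Y∈ , eq′) →
            lo-injective X Y X∈ Y∈ (trans eq (sym eq′))

          lo≤hi : ∀ X → X ∈ T → ¬ hi X < lo X
          lo≤hi X X∈ lt = proj₂ (bound X X∈) (A X) (λ _ Y∈ → Y∈) (A-coherent X)
            (X , proj₁ (bound X X∈) , lt)

          clash : ¬ (Σ[ T′ ∈ Pred ([ Ω ]^ s) 0ℓ ] (T′ ⊆ T × Uncountable T′ ×
            (∀ X Y → X ∈ T′ → Y ∈ T′ → X ≢ Y → hi X < lo Y ⊎ hi Y < lo X)))
          clash (T′ , T′⊆T , unc′ , sep) =
            apart (cross-linked-pair A (s ,_) A-coherent U {Q = T′} unc′ (λ { _ _ _ _ _ refl → refl }) 0)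
            where
            apart : ¬ (∃[ X ] ∃[ Y ] (X ∈ T′ × Y ∈ T′ × X ≢ Y ×
                       CrossLinked (A X) (A Y) × CapturedFrom 0 (s , X) (s , Y)))
            apart (X , Y , X∈ , Y∈ , X≢Y , cross , _) = Sum.[
              (λ lt → proj₂ (bound X (T′⊆T X∈)) (A X ++ A Y) (λ _ → ∈-++⁺ˡ) union-coherent
                        (Y , ∈-++⁺ʳ (A X) (proj₁ (bound Y (T′⊆T Y∈))) , lt)) ,
              (λ lt → proj₂ (bound Y (T′⊆T Y∈)) (A X ++ A Y) (λ _ → ∈-++⁺ʳ (A X)) union-coherent
                        (X , ∈-++⁺ˡ (proj₁ (bound X (T′⊆T X∈))) , lt)) ]
              (sep X Y X∈ Y∈ X≢Y)
              where
              union-coherent : Coherent (A X ++ A Y)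
              union-coherent = Coherent-++ (A-coherent X) (A-coherent Y) cross

      -- Otherwise each singleton {X} would have a bounded coherent extension, contrary to
      -- `bounds⇒⊥`.
      unbounded-condition : Uncountable T → ∃[ A₀ ] (Coherent A₀ × Unbounded A₀)
      unbounded-condition unc = by-contradiction λ none →
        let b , bound = totalize {S = T} {Q = BoundOf}
              (([] , (λ ()) , λ ()) , proj₁ (Uncountable⇒inhabited uncountable)) (bound-of none)
        in bounds⇒⊥ unc b bound
        where
        extension : ∀ {A₀} → ¬ Unbounded A₀ →
          ∃[ A ] ∃[ α ] (A₀ ⊆ˡ A × Coherent A × Bounded A α)
        extension ¬unb = by-contradiction λ none → ¬unb λ A A₀⊆A A-coherent α →
          by-contradiction λ none′ → none (A , α , A₀⊆A , A-coherent ,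
            λ A′ A⊆A′ A′-coherent reaches → none′ (A′ , A⊆A′ , A′-coherent , reaches))

        singleton-coherent : ∀ {X} → X ∈ T → Coherent (X ∷ [])
        singleton-coherent X∈ = (λ { (here refl) → X∈ }) ,
          (λ { (here refl) (here refl) → inj₁ refl })

        bound-of : ¬ (∃[ A₀ ] (Coherent A₀ × Unbounded A₀)) → ∀ X → X ∈ T → ∃[ b ] BoundOf X b
        bound-of none X X∈ =
          let A , α , ⊆A , A-coherent , bounded =
                extension (λ unb → none (X ∷ [] , singleton-coherent X∈ , unb))
          in ((A , A-coherent) , α) , ⊆A X (here refl) , bounded

      -- There are only ω₁ sets `D α`, so one filter meets them all. Its union reaches beyond every
      -- α and is uncountable by `Countable⇒bounded`; directedness puts any two members into one
      -- condition.
      linked-subfamily : 𝔪Δ>ω₁ S → Uncountable T →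
        Σ[ T′ ∈ Pred ([ Ω ]^ s) 0ℓ ] (T′ ⊆ T × Uncountable T′ ×
          (∀ X Y → X ∈ T′ → Y ∈ T′ → Linked N X Y))
      linked-subfamily 𝔪> unc = build (unbounded-condition unc)
        where
        LinkedSubfamily : Set₁
        LinkedSubfamily = Σ[ T′ ∈ Pred ([ Ω ]^ s) 0ℓ ] (T′ ⊆ T × Uncountable T′ ×
          (∀ X Y → X ∈ T′ → Y ∈ T′ → Linked N X Y))

        build : ∃[ A₀ ] (Coherent A₀ × Unbounded A₀) → LinkedSubfamily
        build (A₀ , A₀-coherent , unbounded) = from-filter (by-contradiction λ none →
          𝔪> ℙ (linking-ccc A₀-coherent) (linking-preserves A₀-coherent) Ordinal
            (D , D-dense , none) (mk↣ {to = id} id))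
          where
          ℙ : Forcing
          ℙ = linking A₀-coherent

          open Forcing ℙ using (Condition)

          D : Ordinal → Pred Condition 0ℓ
          D α p = Reaches α (proj₁ p)

          D-dense : ∀ α → Dense ℙ (D α)
          D-dense α (A , A₀⊆A , A-coherent) =
            let A′ , A⊆A′ , A′-coherent , reaches = unbounded A A₀⊆A A-coherent α
            in (A′ , (λ X X∈ → A⊆A′ X (A₀⊆A X X∈)) , A′-coherent) , A⊆A′ , reaches

          from-filter : Σ[ G ∈ Pred Condition 0ℓ ]
            (IsFilter ℙ G × (∀ α → ∃[ p ] (p ∈ G × p ∈ D α))) → LinkedSubfamily
          from-filter (G , filter , meets) = T′ , T′⊆T , T′-unc , linked
            where
            T′ : Pred ([ Ω ]^ s) 0ℓ
            T′ X = ∃[ p ] (p ∈ G × X ∈ˡ proj₁ p)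

            T′⊆T : T′ ⊆ T
            T′⊆T ((A , _ , A⊆T , _) , _ , X∈) = A⊆T X∈

            T′-unc : Uncountable T′
            T′-unc ct =
              let α , bound = Countable⇒bounded {S = T′} ct lo
                  p , p∈G , X , X∈p , α<loX = meets α
              in IsStrictTotalOrder.asym isStrictTotalOrder α<loX (bound X (p , p∈G , X∈p))

            linked : ∀ X Y → X ∈ T′ → Y ∈ T′ → Linked N X Y
            linked X Y (p , p∈G , X∈p) (q , q∈G , Y∈q) =
              let (A , _ , _ , A-linked) , _ , p⊆ , q⊆ = IsFilter.directed filter p q p∈G q∈G
              in A-linked (p⊆ X X∈p) (q⊆ Y Y∈q)

-- From an uncountable linked family to an uncountable antichain.

fixed-size : {Ω : Omega₁} {𝓢 : Pred (FinSubset Ω) 0ℓ} (s : ℕ) →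
  Uncountable (λ E → E ∈ 𝓢 × proj₁ E ≡ s) → Uncountable (λ (X : [ Ω ]^ s) → (s , X) ∈ 𝓢)
fixed-size {Ω} {𝓢} s unc (f , f-inj) = unc (g , g-inj)
  where
  at : (E : FinSubset Ω) → Dec (proj₁ E ≡ s) → ℕ
  at (_ , X) (yes refl) = f X
  at _       (no _)     = 0

  g : FinSubset Ω → ℕ
  g E = at E (proj₁ E ℕ.≟ s)

  g-inj : ∀ E F → (E ∈ 𝓢 × proj₁ E ≡ s) → (F ∈ 𝓢 × proj₁ F ≡ s) → g E ≡ g F → E ≡ F
  g-inj (_ , X) (_ , Y) (X∈ , refl) (Y∈ , refl) eq with s ℕ.≟ s
  ... | yes refl = cong (s ,_) (f-inj X Y X∈ Y∈ eq)
  ... | no  s≢s  = contradiction refl s≢s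

mainTheorem11 : (∀ {ℓ} → ExcludedMiddle ℓ) →
    (Ω : Omega₁) (τ : SchemeType) (𝓕 : ConstructionScheme Ω τ) →
    TwoΔCapturing 𝓕 →
    𝔪Δ>ω₁ 𝓕 →
    (P : Forcing) → CCC P → TwoΔPreserves P 𝓕
mainTheorem11 em Ω τ 𝓕 capturing 𝔪> P ccc =
  compatible-captures⇒preserves 𝓕 λ 𝓢 unc c N → by-contradiction λ none →
    let s , unc-s = pigeonhole unc proj₁
        T , T⊆ , T-unc , U , lo , lo-inj = Δ-system-lemma (fixed-size {𝓢 = 𝓢} s unc-s)
        T′ , T′⊆T , T′-unc , linked =
          LinkedSubfamilies.linked-subfamily em 𝓕 capturing N U lo lo-inj 𝔪> T-unc
    in uncountable-antichain 𝓢 c N none s T′ (λ X X∈ → T⊆ (T′⊆T X∈)) T′-unc linked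
  where
  open Classical em
  open Captures em 𝓕
  open ΔSystemLemma em 𝓕
  open Preservation em P
  open Forcing P

  uncountable-antichain : ∀ 𝓢 c N → ¬ CompatibleCapture 𝓕 𝓢 c N →
    ∀ s (T : Pred ([ Ω ]^ s) 0ℓ) → (∀ X → X ∈ T → (s , X) ∈ 𝓢) → Uncountable T →
    ¬ (∀ X Y → X ∈ T → Y ∈ T → Linked N X Y)
  uncountable-antichain 𝓢 c N none s T T⊆ unc linked =
    Uncountable-Image c′ c′-inj unc (ccc (Image c′ T) antichain)
    where
    c′ : [ Ω ]^ s → Condition
    c′ X = c (s , X)

    capture : ∀ {l X Y} → X ∈ T → Y ∈ T → N ℕ.≤ l → ΔCaptured 𝓕 ⟦ X , Y ⟧ l →
              ¬ Compatible P (c′ X) (c′ Y)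
    capture X∈ Y∈ N≤l cap compatible = none
      (_ , N≤l , s , ⟦ _ , _ ⟧ , (λ { zero → T⊆ _ X∈ ; one → T⊆ _ Y∈ }) , cap , compatible)

    -- Compatibility is symmetric while capture is ordered, so a link in either order contradicts
    -- `none`.
    compatible⇒≡ : ∀ X Y → X ∈ T → Y ∈ T → Compatible P (c′ X) (c′ Y) → X ≡ Y
    compatible⇒≡ X Y X∈ Y∈ (r , r≤ , r≤′) with linked X Y X∈ Y∈
    ... | inj₁ X≡Y                  = X≡Y
    ... | inj₂ (_ , N≤l , inj₁ cap) = contradiction (r , r≤ , r≤′) (capture X∈ Y∈ N≤l cap)
    ... | inj₂ (_ , N≤l , inj₂ cap) = contradiction (r , r≤′ , r≤) (capture Y∈ X∈ N≤l cap)

    c′-inj : ∀ X Y → X ∈ T → Y ∈ T → c′ X ≡ c′ Y → X ≡ Y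
    -- Equal conditions are compatible, so `c′` cannot identify members of `T`.
    c′-inj X Y X∈ Y∈ eq = compatible⇒≡ X Y X∈ Y∈
      (c′ X , reflexive refl , reflexive eq)
      where open IsPreorder isPreorder using (reflexive)

    antichain : Antichain P (Image c′ T)
    antichain _ _ (X , X∈ , refl) (Y , Y∈ , refl) p≢q compatible =
      p≢q (cong c′ (compatible⇒≡ X Y X∈ Y∈ compatible))
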